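{- The family of associahedra, oriented by the Tamari order, is $2$-short, has asymptotic $k$-length $\frac{k-2}{2k-2}$ for every $k>2$, and has asymptotic total length $\frac12$.
   Context: An oriented polytope is a convex polytope $P\subset\mathbb{R}^d$ together with a linear functional $\psi$ that is not constant along any edge of $P$. The functional orients each edge, and the vertex set of $P$ becomes a poset by taking the reflexive-transitive closure of this orientation. Every nonempty face has a unique bottom vertex and a unique top vertex. For nonempty faces $F,G$ write $F\le G$ if the top vertex of $F$ is less than or equal to the bottom vertex of $G$ in the vertex poset of $P$. A face chain of length $k$ in $P$ is a sequence $\mathbf{F}=(F_1\le F_2\le\cdots\le F_k)$ of nonempty faces of $P$. Its excess is $\mathrm{exc}(\mathbf{F})=(\dim P-1)-\sum_{i=1}^k(\dim F_i-1)$. Let $e_k(P)$ be the minimum excess of a length $k$ face chain in $P$ (for $k=1$ the trivial chain consisting of $P$ itself is excluded). Let $E_k(n)=(n-1)-k(n-2)=(1-k)n+2k-1$. A family of polytopes $P^\bullet$ consists of one oriented polytope $P^n$ of dimension $n$ for each $n\ge1$. The family is $2$-short if in each $P^n$ every face chain of length $2$ has positive excess. It has asymptotic $k$-length $\alpha_k$ if $\lim_{n\to\infty} e_k(P^n)/E_k(n)=\alpha_k$. It has asymptotic total length $\alpha$ if the $\alpha_k$ are well-defined for every $k$ and $\lim_{k\to\infty}\alpha_k=\alpha$. The associahedron $K(N)$ is the $(N-2)$-dimensional polytope (Loday's realization) whose poset of nonempty faces is isomorphic to the poset of planar rooted trees with $N$ leaves in which every inner vertex has at least two children, ordered by contraction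 of inner edges (contracting inner edges gives larger faces). The face labelled by a tree with $e$ inner edges has dimension $N-2-e$. Vertices correspond to planar binary rooted trees. A linear functional orients the $1$-skeleton so that the vertex poset is the Tamari order, whose generating relations are right rotations of a tree: replacing a subtree $((A\,B)\,C)$ by $(A\,(B\,C))$ makes the tree larger. Thus the left comb is the minimum and the right comb is the maximum. The $n$-dimensional member of the family of associahedra is $K(n+2)$. -}

module Defs where

open import Data.Empty using (⊥-elim)
open import Data.Integer.Base as ℤ using (ℤ; +_; -[1+_])
open import Data.List.Base using (List; []; _∷_; _++_; length; replicate; map; cartesianProductWith)
open import Data.List.Properties using (++-assoc; ++-identityʳ; length-++)
open import Data.List.Membership.Propositional using (_∈_)
open import Data.List.Membership.Propositional.Properties
  using (∈-cartesianProductWith⁺; ∈-++⁺ˡ; ∈-++⁺ʳ)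
open import Data.List.Relation.Unary.All using (All; []; _∷_)
open import Data.List.Relation.Unary.Any using (here; there)
open import Data.Nat.Base as ℕ using (ℕ; zero; suc; pred; _+_; _*_; _∸_; _≤_; _<_; z≤n; s≤s; NonZero)
open import Data.Nat.Properties as ℕₚ using (_≟_)
open import Data.Nat.Tactic.RingSolver using (solve-∀)
open import Data.Product.Base using (Σ; Σ-syntax; ∃; ∃-syntax; _×_; _,_; proj₁; proj₂)
open import Data.Rational.Base as ℚ using (ℚ; 0ℚ)
open import Data.Sum.Base using (_⊎_; inj₁; inj₂)
open import Data.Vec.Base as Vec using (Vec)
open import Data.Vec.Relation.Unary.Linked using (Linked)
open import Relation.Binary.Construct.Closure.ReflexiveTransitive using (Star; ε; _◅_; _◅◅_; gmap)
open import Relation.Binary.PropositionalEquality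
  using (_≡_; _≢_; refl; sym; trans; cong; cong₂; subst; isEquivalence; module ≡-Reasoning)
open import Relation.Binary.Structures using (IsPartialOrder)
open import Relation.Nullary using (¬_; yes; no)

-- The combinatorial data that a convex polytope P ⊂ ℝᵈ and a linear functional
-- not constant along any edge determine: the graded poset of nonempty faces
-- and the orientation of the edges.  ψ plays the part of the functional,
-- restricted to the vertices; as there are finitely many vertices and only the
-- order of the values matters, it may be taken ℕ-valued.

record OrientedPolytope : Set₁ where
  infix 4 _⊆_ _⟶_ _≤ᵥ_ _≼_
  field
    Face           : Set
    _⊆_            : Face → Face → Set
    isPartialOrder : IsPartialOrder _≡_ _⊆_
    finite         : Σ[ Fs ∈ List Face ] (∀ F → F ∈ Fs)
    whole          : Face
    ⊆-whole        : ∀ F → F ⊆ whole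
    dim            : Face → ℕ
    dim-strict     : ∀ {F G} → F ⊆ G → F ≢ G → dim F < dim G

  Vertex : Set
  Vertex = Σ[ F ∈ Face ] dim F ≡ 0

  field
    _⟶_ : Vertex → Vertex → Set
    ψ   : Vertex → ℕ
    ψ-strict : ∀ {v w} → v ⟶ w → ψ v < ψ w

  _≤ᵥ_ : Vertex → Vertex → Set
  _≤ᵥ_ = Star _⟶_

  field
    bottom top : Face → Vertex
    bottom-⊆   : ∀ F → proj₁ (bottom F) ⊆ F
    top-⊆      : ∀ F → proj₁ (top F) ⊆ F
    bottom-min : ∀ {F} v → proj₁ v ⊆ F → bottom F ≤ᵥ v
    top-max    : ∀ {F} v → proj₁ v ⊆ F → v ≤ᵥ top F

    -- The arrows are exactly the edges, each with its two endpoints.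
    edge-⟶        : ∀ {E} → dim E ≡ 1 → bottom E ⟶ top E
    edge-vertices : ∀ {E} → dim E ≡ 1 → ∀ v → proj₁ v ⊆ E → v ≡ bottom E ⊎ v ≡ top E
    ⟶-edge        : ∀ {v w} → v ⟶ w → ∃[ E ] dim E ≡ 1 × bottom E ≡ v × top E ≡ w

  _≼_ : Face → Face → Set
  F ≼ G = top F ≤ᵥ bottom G

  dimension : ℕ
  dimension = dim whole

open OrientedPolytope using (Face; whole; dim; dimension)

record FaceChain (P : OrientedPolytope) (k : ℕ) : Set where
  constructor faceChain
  field
    faces  : Vec (Face P) k
    linked : Linked (OrientedPolytope._≼_ P) faces

open FaceChain public

sumℤ : ∀ {k} → Vec ℤ k → ℤ
sumℤ = Vec.foldr′ ℤ._+_ (+ 0)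

excess : (P : OrientedPolytope) {k : ℕ} → FaceChain P k → ℤ
excess P c =
  (+ dimension P ℤ.- + 1) ℤ.- sumℤ (Vec.map (λ F → + dim P F ℤ.- + 1) (faces c))

-- Excludes the chain of length 1 consisting of P itself.
Admissible : (P : OrientedPolytope) {k : ℕ} → FaceChain P k → Set
Admissible P c = Vec.toList (faces c) ≢ whole P ∷ []

-- m is e_k(P).
IsMinExcess : (P : OrientedPolytope) (k : ℕ) → ℤ → Set
IsMinExcess P k m =
  (Σ[ c ∈ FaceChain P k ] Admissible P c × excess P c ≡ m) ×
  (∀ (c : FaceChain P k) → Admissible P c → m ℤ.≤ excess P c)

E : ℕ → ℕ → ℤ
E k n = (+ n ℤ.- + 1) ℤ.- + k ℤ.* (+ n ℤ.- + 2)

record Family : Set₁ where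
  field
    member    : (n : ℕ) → .{{NonZero n}} → OrientedPolytope
    dimension≡ : (n : ℕ) → .{{_ : NonZero n}} → dimension (member n) ≡ n

open Family public

TwoShort : Family → Set
TwoShort 𝓟 = (n : ℕ) → .{{_ : NonZero n}} →
  (c : FaceChain (member 𝓟 n) 2) → + 0 ℤ.< excess (member 𝓟 n) c

-- p / q, with the convention p / 0 = 0.  For k, n ≥ 1 the denominator E k n
-- vanishes only at k = 2, n = 3, which does not affect a limit in n.
ratio : ℤ → ℤ → ℚ
ratio p (+ zero)    = 0ℚ
ratio p (+ (suc q)) = p ℚ./ suc q
ratio p -[1+ q ]    = (ℤ.- p) ℚ./ suc q

Limit : (ℕ → ℚ) → ℚ → Set
Limit a α = ∀ (δ : ℚ) → 0ℚ ℚ.< δ →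
  ∃[ N ] (∀ n → N ≤ n → ℚ.∣ a n ℚ.- α ∣ ℚ.< δ)

HasAsymptoticLength : Family → ℕ → ℚ → Set
HasAsymptoticLength 𝓟 k α =
  Σ[ e ∈ (ℕ → ℤ) ]
    ((n : ℕ) → .{{_ : NonZero n}} → IsMinExcess (member 𝓟 n) k (e n)) ×
    Limit (λ n → ratio (e n) (E k n)) α

HasAsymptoticTotalLength : Family → ℚ → Set
HasAsymptoticTotalLength 𝓟 α =
  Σ[ a ∈ (ℕ → ℚ) ]
    ((k : ℕ) → .{{_ : NonZero k}} → HasAsymptoticLength 𝓟 k (a k)) ×
    Limit a α

-- The arguments of node are the first, the second and the remaining subtrees.
data Tree : Set where
  leaf : Tree
  node : Tree → Tree → List Tree → Tree

pattern fork a b = node a b []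

leaves  : Tree → ℕ
leavesᶠ : List Tree → ℕ
leaves leaf          = 1
leaves (node a b cs) = leaves a + (leaves b + leavesᶠ cs)
leavesᶠ []       = 0
leavesᶠ (t ∷ ts) = leaves t + leavesᶠ ts

innerVertices  : Tree → ℕ
innerVerticesᶠ : List Tree → ℕ
innerVertices leaf          = 0
innerVertices (node a b cs) =
  suc (innerVertices a + (innerVertices b + innerVerticesᶠ cs))
innerVerticesᶠ []       = 0
innerVerticesᶠ (t ∷ ts) = innerVertices t + innerVerticesᶠ ts

-- Every inner vertex but the root is the upper end of exactly one inner edge.
innerEdges : Tree → ℕ
innerEdges t = pred (innerVertices t)

-- s ⇒ t: contracting one inner edge of s gives t.  ss ⇒ᶠ ts: the same for the
-- list of subtrees of a vertex, where the edge may join that vertex to a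
-- subtree's root (contract).
infix 4 _⇒_ _⇒ᶠ_ _↝_
data _⇒_  : Tree → Tree → Set
data _⇒ᶠ_ : List Tree → List Tree → Set

data _⇒_ where
  node : ∀ {a b cs a′ b′ cs′} →
         a ∷ b ∷ cs ⇒ᶠ a′ ∷ b′ ∷ cs′ → node a b cs ⇒ node a′ b′ cs′

data _⇒ᶠ_ where
  contract : ∀ {a b cs ts} → node a b cs ∷ ts ⇒ᶠ a ∷ b ∷ cs ++ ts
  here     : ∀ {s t ts} → s ⇒ t → s ∷ ts ⇒ᶠ t ∷ ts
  there    : ∀ {t ss ts} → ss ⇒ᶠ ts → t ∷ ss ⇒ᶠ t ∷ ts

-- Only used between binary trees; rotations generate the Tamari order.
data _↝_ : Tree → Tree → Set where
  rotate : ∀ {a b c} → fork (fork a b) c ↝ fork a (fork b c)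
  left   : ∀ {a a′ b} → a ↝ a′ → fork a b ↝ fork a′ b
  right  : ∀ {a b b′} → b ↝ b′ → fork a b ↝ fork a b′

-- Every inner vertex replaced by a left comb, respectively a right comb.
bottomᵗ : Tree → Tree
lcomb   : Tree → List Tree → Tree
bottomᵗ leaf          = leaf
bottomᵗ (node a b cs) = lcomb (fork (bottomᵗ a) (bottomᵗ b)) cs
lcomb t []       = t
lcomb t (u ∷ us) = lcomb (fork t (bottomᵗ u)) us

topᵗ  : Tree → Tree
rcomb : Tree → List Tree → Tree
topᵗ leaf          = leaf
topᵗ (node a b cs) = fork (topᵗ a) (rcomb b cs)
rcomb t []       = topᵗ t
rcomb t (u ∷ us) = fork (topᵗ t) (rcomb u us)

-- Loday's coordinates of a binary tree: for each inner vertex, from left to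
-- right, the product of the numbers of leaves of its two subtrees.
-- (The value on other trees is irrelevant.)
loday : Tree → List ℕ
loday leaf         = []
loday (node a b _) = loday a ++ (leaves a * leaves b) ∷ loday b

-- The linear functional with coefficients (d , d - 1 , … , 1) on ℝᵈ.
functional : List ℕ → ℕ
functional []       = 0
functional (x ∷ xs) = suc (length xs) * x + functional xs

defect  : Tree → ℕ
defectᶠ : List Tree → ℕ
defect leaf          = 0
defect (node a b cs) = defect a + (defect b + defectᶠ cs)
defectᶠ []       = 0
defectᶠ (t ∷ ts) = suc (defect t + defectᶠ ts)

leaves≡  : ∀ t → leaves t ≡ suc (innerVertices t + defect t)
leavesᶠ≡ : ∀ ts → leavesᶠ ts ≡ innerVerticesᶠ ts + defectᶠ ts
leaves≡ leaf = refl
leaves≡ (node a b cs) rewrite leaves≡ a | leaves≡ b | leavesᶠ≡ cs =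
  lemma (innerVertices a) (defect a) (innerVertices b) (defect b) (innerVerticesᶠ cs) (defectᶠ cs)
  where
  lemma : ∀ ia da ib db ic dc →
    suc (ia + da) + (suc (ib + db) + (ic + dc)) ≡ suc (suc (ia + (ib + ic)) + (da + (db + dc)))
  lemma = solve-∀
leavesᶠ≡ [] = refl
leavesᶠ≡ (t ∷ ts) rewrite leaves≡ t | leavesᶠ≡ ts =
  lemma (innerVertices t) (defect t) (innerVerticesᶠ ts) (defectᶠ ts)
  where
  lemma : ∀ i d j e → suc (i + d) + (j + e) ≡ (i + j) + suc (d + e)
  lemma = solve-∀

HasLeaves : ℕ → Tree → Set
HasLeaves n t = leaves t ≡ 2 + n

TreeWith : ℕ → Set
TreeWith n = Σ Tree (HasLeaves n)

-- A tree with N = 2 + n leaves has dimension N - 2 - e, and n ≥ e always.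
treeDim : ∀ {n} → TreeWith n → ℕ
treeDim {n} (t , _) = n ∸ innerEdges t

treeDim≡defect : ∀ {n} (F : TreeWith n) → treeDim F ≡ defect (proj₁ F)
treeDim≡defect {n} (leaf , ())
treeDim≡defect {n} (t@(node a b cs) , p) = begin
  n ∸ innerEdges t                        ≡⟨ cong (_∸ innerEdges t) n≡ ⟩
  innerEdges t + defect t ∸ innerEdges t  ≡⟨ ℕₚ.m+n∸m≡n (innerEdges t) (defect t) ⟩
  defect t                                ∎
  where
  open ≡-Reasoning
  n≡ : n ≡ innerEdges t + defect t
  n≡ = ℕₚ.suc-injective (ℕₚ.suc-injective (trans (sym p) (leaves≡ t)))

leavesᶠ-++ : ∀ ss ts → leavesᶠ (ss ++ ts) ≡ leavesᶠ ss + leavesᶠ ts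
leavesᶠ-++ [] ts = refl
leavesᶠ-++ (s ∷ ss) ts rewrite leavesᶠ-++ ss ts =
  sym (ℕₚ.+-assoc (leaves s) (leavesᶠ ss) (leavesᶠ ts))

defectᶠ-++ : ∀ ss ts → defectᶠ (ss ++ ts) ≡ defectᶠ ss + defectᶠ ts
defectᶠ-++ [] ts = refl
defectᶠ-++ (s ∷ ss) ts rewrite defectᶠ-++ ss ts =
  cong suc (sym (ℕₚ.+-assoc (defect s) (defectᶠ ss) (defectᶠ ts)))

leaves-⇒  : ∀ {s t} → s ⇒ t → leaves s ≡ leaves t
leaves-⇒ᶠ : ∀ {ss ts} → ss ⇒ᶠ ts → leavesᶠ ss ≡ leavesᶠ ts
leaves-⇒ (node p) = leaves-⇒ᶠ p
leaves-⇒ᶠ (contract {a} {b} {cs} {ts}) rewrite leavesᶠ-++ cs ts =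
  lemma (leaves a) (leaves b) (leavesᶠ cs) (leavesᶠ ts)
  where
  lemma : ∀ a b c t → a + (b + c) + t ≡ a + (b + (c + t))
  lemma = solve-∀
leaves-⇒ᶠ (here {ts = ts} p) = cong (_+ leavesᶠ ts) (leaves-⇒ p)
leaves-⇒ᶠ (there {t = t} p)  = cong (_+_ (leaves t)) (leaves-⇒ᶠ p)

leaves-⇒* : ∀ {s t} → Star _⇒_ s t → leaves s ≡ leaves t
leaves-⇒* ε        = refl
leaves-⇒* (p ◅ ps) = trans (leaves-⇒ p) (leaves-⇒* ps)

defect-⇒  : ∀ {s t} → s ⇒ t → defect t ≡ suc (defect s)
defect-⇒ᶠ : ∀ {ss ts} → ss ⇒ᶠ ts → defectᶠ ts ≡ suc (defectᶠ ss)
defect-⇒ (node {a} {b} {cs} {a′} {b′} {cs′} p) = ℕₚ.suc-injective (ℕₚ.suc-injective (begin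
  2 + (defect a′ + (defect b′ + defectᶠ cs′)) ≡⟨ lemma (defect a′) (defect b′) (defectᶠ cs′) ⟩
  defectᶠ (a′ ∷ b′ ∷ cs′)                     ≡⟨ defect-⇒ᶠ p ⟩
  suc (defectᶠ (a ∷ b ∷ cs))                  ≡⟨ cong suc (sym (lemma (defect a) (defect b) (defectᶠ cs))) ⟩
  3 + (defect a + (defect b + defectᶠ cs))    ∎))
  where
  open ≡-Reasoning
  lemma : ∀ a b c → 2 + (a + (b + c)) ≡ suc (a + suc (b + c))
  lemma = solve-∀
defect-⇒ᶠ (contract {a} {b} {cs} {ts}) rewrite defectᶠ-++ cs ts =
  lemma (defect a) (defect b) (defectᶠ cs) (defectᶠ ts)
  where
  lemma : ∀ a b c t → suc (a + suc (b + (c + t))) ≡ suc (suc (a + (b + c) + t))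
  lemma = solve-∀
defect-⇒ᶠ (here {ts = ts} p) rewrite defect-⇒ p = refl
defect-⇒ᶠ (there {t = t} {ss} p) rewrite defect-⇒ᶠ p = cong suc (ℕₚ.+-suc (defect t) (defectᶠ ss))

defect-⇒* : ∀ {s t} → Star _⇒_ s t → s ≡ t ⊎ defect s < defect t
defect-⇒* ε = inj₁ refl
defect-⇒* (p ◅ ps) with defect-⇒* ps
... | inj₁ refl = inj₂ (ℕₚ.≤-reflexive (sym (defect-⇒ p)))
... | inj₂ lt   = inj₂ (ℕₚ.≤-trans (ℕₚ.≤-reflexive (sym (defect-⇒ p))) (ℕₚ.<⇒≤ lt))

⇒*-antisym : ∀ {s t} → Star _⇒_ s t → Star _⇒_ t s → s ≡ t
⇒*-antisym p q with defect-⇒* p | defect-⇒* q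
... | inj₁ s≡t | _        = s≡t
... | inj₂ _   | inj₁ t≡s = sym t≡s
... | inj₂ lt  | inj₂ gt  = ⊥-elim (ℕₚ.<-asym lt gt)

TreeWith-≡ : ∀ {n} {F G : TreeWith n} → proj₁ F ≡ proj₁ G → F ≡ G
TreeWith-≡ {F = _ , p} {_ , q} refl = cong (_ ,_) (ℕₚ.≡-irrelevant p q)

node-⇒* : ∀ {a b cs a′ b′ cs′} →
  Star _⇒ᶠ_ (a ∷ b ∷ cs) (a′ ∷ b′ ∷ cs′) → Star _⇒_ (node a b cs) (node a′ b′ cs′)
node-⇒* ε = ε
node-⇒* (p@contract ◅ ps)           = node p ◅ node-⇒* ps
node-⇒* (p@(here _) ◅ ps)           = node p ◅ node-⇒* ps
node-⇒* (p@(there contract) ◅ ps)   = node p ◅ node-⇒* ps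
node-⇒* (p@(there (here _)) ◅ ps)   = node p ◅ node-⇒* ps
node-⇒* (p@(there (there _)) ◅ ps)  = node p ◅ node-⇒* ps

here* : ∀ {s t ts} → Star _⇒_ s t → Star _⇒ᶠ_ (s ∷ ts) (t ∷ ts)
here* = gmap _ here

there* : ∀ {t ss ts} → Star _⇒ᶠ_ ss ts → Star _⇒ᶠ_ (t ∷ ss) (t ∷ ts)
there* = gmap _ there

corolla : ℕ → Tree
corolla n = node leaf leaf (replicate n leaf)

leaves-replicate : ∀ n → leavesᶠ (replicate n leaf) ≡ n
leaves-replicate zero    = refl
leaves-replicate (suc n) = cong suc (leaves-replicate n)

replicate-+ : ∀ m n → replicate m leaf ++ replicate n leaf ≡ replicate (m + n) leaf
replicate-+ zero    n = refl
replicate-+ (suc m) n = cong (leaf ∷_) (replicate-+ m n)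

leaves>0 : ∀ t → 0 < leaves t
leaves>0 t rewrite leaves≡ t = s≤s z≤n

flatten     : ∀ t ts → Star _⇒ᶠ_ (t ∷ ts) (replicate (leaves t) leaf ++ ts)
flattenᶠ    : ∀ ts → Star _⇒ᶠ_ ts (replicate (leavesᶠ ts) leaf)
to-corolla  : ∀ {n} t → leaves t ≡ 2 + n → Star _⇒_ t (corolla n)
flattenᶠ [] = ε
flattenᶠ (t ∷ ts) =
  there* (flattenᶠ ts) ◅◅
  subst (Star _⇒ᶠ_ _) (replicate-+ (leaves t) (leavesᶠ ts)) (flatten t (replicate (leavesᶠ ts) leaf))
flatten leaf ts = ε
flatten (node a b cs) ts with leaves a + (leaves b + leavesᶠ cs) in eq
... | zero = ⊥-elim (ℕₚ.<⇒≢ (leaves>0 (node a b cs)) (sym eq))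
... | suc zero = ⊥-elim (ℕₚ.<⇒≢ (ℕₚ.+-mono-≤ (leaves>0 a) (ℕₚ.≤-trans (leaves>0 b) (ℕₚ.m≤m+n _ (leavesᶠ cs)))) (sym eq))
... | suc (suc n) =
  here* (node-⇒* (subst (Star _⇒ᶠ_ _) (cong (λ l → replicate l leaf) eq)
    (there* (there* (flattenᶠ cs)) ◅◅
     (there* (flatten b (replicate (leavesᶠ cs) leaf)) ◅◅
      subst (Star _⇒ᶠ_ (a ∷ replicate (leaves b) leaf ++ replicate (leavesᶠ cs) leaf))
            (trans (cong (replicate (leaves a) leaf ++_) (replicate-+ (leaves b) (leavesᶠ cs)))
                   (replicate-+ (leaves a) (leaves b + leavesᶠ cs)))
            (flatten a (replicate (leaves b) leaf ++ replicate (leavesᶠ cs) leaf))))))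
  ◅◅ (contract ◅ ε)
to-corolla leaf ()
to-corolla {n} (node a b cs) p =
  node-⇒* (subst (Star _⇒ᶠ_ _) (cong (λ l → replicate l leaf) p) (flattenᶠ (a ∷ b ∷ cs)))

data Binary : Tree → Set where
  leaf : Binary leaf
  bin  : ∀ {a b} → Binary a → Binary b → Binary (fork a b)

toBinary : ∀ t → defect t ≡ 0 → Binary t
toBinary leaf _ = leaf
toBinary (node a b []) p =
  bin (toBinary a (ℕₚ.m+n≡0⇒m≡0 (defect a) p))
       (toBinary b (ℕₚ.m+n≡0⇒m≡0 (defect b) (ℕₚ.m+n≡0⇒n≡0 (defect a) p)))
toBinary (node a b (c ∷ cs)) p
  with () ← ℕₚ.m+n≡0⇒n≡0 (defect b) (ℕₚ.m+n≡0⇒n≡0 (defect a) p)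

fromBinary : ∀ {t} → Binary t → defect t ≡ 0
fromBinary leaf = refl
fromBinary (bin p q) rewrite fromBinary p | fromBinary q = refl

bottomᵗ-Binary : ∀ t → Binary (bottomᵗ t)
lcomb-Binary   : ∀ {t} us → Binary t → Binary (lcomb t us)
bottomᵗ-Binary leaf          = leaf
bottomᵗ-Binary (node a b cs) = lcomb-Binary cs (bin (bottomᵗ-Binary a) (bottomᵗ-Binary b))
lcomb-Binary []       p = p
lcomb-Binary (u ∷ us) p = lcomb-Binary us (bin p (bottomᵗ-Binary u))

topᵗ-Binary  : ∀ t → Binary (topᵗ t)
rcomb-Binary : ∀ t us → Binary (rcomb t us)
topᵗ-Binary leaf          = leaf
topᵗ-Binary (node a b cs) = bin (topᵗ-Binary a) (rcomb-Binary b cs)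
rcomb-Binary t []       = topᵗ-Binary t
rcomb-Binary t (u ∷ us) = bin (topᵗ-Binary t) (rcomb-Binary u us)

bottomᵗ-fixed : ∀ {t} → Binary t → bottomᵗ t ≡ t
bottomᵗ-fixed leaf       = refl
bottomᵗ-fixed (bin p q) = cong₂ (λ a b → fork a b) (bottomᵗ-fixed p) (bottomᵗ-fixed q)

topᵗ-fixed : ∀ {t} → Binary t → topᵗ t ≡ t
topᵗ-fixed leaf       = refl
topᵗ-fixed (bin p q) = cong₂ (λ a b → fork a b) (topᵗ-fixed p) (topᵗ-fixed q)

lcomb-mono-⇒* : ∀ {s t} us → Star _⇒_ s t → Star _⇒_ (lcomb s us) (lcomb t us)
lcomb-mono-⇒* []       p = p
lcomb-mono-⇒* (u ∷ us) p = lcomb-mono-⇒* us (node-⇒* (here* p))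

bottomᵗ-⇒* : ∀ t → Star _⇒_ (bottomᵗ t) t
lcomb-⇒*   : ∀ a b ds cs → Star _⇒_ (lcomb (node a b ds) cs) (node a b (ds ++ cs))
++-⇒ᶠ*     : ∀ ds {ss ts} → Star _⇒ᶠ_ ss ts → Star _⇒ᶠ_ (ds ++ ss) (ds ++ ts)
bottomᵗ-⇒* leaf = ε
bottomᵗ-⇒* (node a b cs) =
  lcomb-⇒* (bottomᵗ a) (bottomᵗ b) [] cs ◅◅
  node-⇒* (here* (bottomᵗ-⇒* a) ◅◅ there* (here* (bottomᵗ-⇒* b)))
lcomb-⇒* a b ds [] =
  subst (λ es → Star _⇒_ (node a b ds) (node a b es)) (sym (++-identityʳ ds)) ε
lcomb-⇒* a b ds (c ∷ cs) =
  lcomb-mono-⇒* cs (node contract ◅ node-⇒* (++-⇒ᶠ* (a ∷ b ∷ ds) (here* (bottomᵗ-⇒* c)))) ◅◅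
  subst (λ es → Star _⇒_ (lcomb (node a b (ds ++ c ∷ [])) cs) (node a b es))
        (++-assoc ds (c ∷ []) cs)
        (lcomb-⇒* a b (ds ++ c ∷ []) cs)
++-⇒ᶠ* []       p = p
++-⇒ᶠ* (d ∷ ds) p = there* (++-⇒ᶠ* ds p)

topᵗ-⇒*  : ∀ t → Star _⇒_ (topᵗ t) t
rcomb-⇒* : ∀ a b cs → Star _⇒_ (fork a (rcomb b cs)) (node a b cs)
topᵗ-⇒* leaf          = ε
topᵗ-⇒* (node a b cs) = rcomb-⇒* (topᵗ a) b cs ◅◅ node-⇒* (here* (topᵗ-⇒* a))
rcomb-⇒* a b []       = node-⇒* (there* (here* (topᵗ-⇒* b)))
rcomb-⇒* a b (c ∷ cs) =
  node-⇒* (there* (here* (rcomb-⇒* (topᵗ b) c cs))) ◅◅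
  (node (there contract) ◅
   subst (λ es → Star _⇒_ (node a (topᵗ b) (c ∷ cs ++ [])) (node a b (c ∷ es)))
         (++-identityʳ cs)
         (node-⇒* (there* (here* (topᵗ-⇒* b)))))

leaves-↝ : ∀ {s t} → s ↝ t → leaves s ≡ leaves t
leaves-↝ (rotate {a} {b} {c}) = lemma (leaves a) (leaves b) (leaves c)
  where
  lemma : ∀ a b c → a + (b + 0) + (c + 0) ≡ a + (b + (c + 0) + 0)
  lemma = solve-∀
leaves-↝ (left {b = b} p)  = cong (_+ (leaves b + 0)) (leaves-↝ p)
leaves-↝ (right {a = a} p) = cong (λ l → leaves a + (l + 0)) (leaves-↝ p)

Binary-↝ : ∀ {s t} → s ↝ t → Binary s → Binary t
Binary-↝ rotate    (bin (bin p q) r) = bin p (bin q r)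
Binary-↝ (left s)  (bin p q) = bin (Binary-↝ s p) q
Binary-↝ (right s) (bin p q) = bin p (Binary-↝ s q)

left* : ∀ {a a′ b} → Star _↝_ a a′ → Star _↝_ (fork a b) (fork a′ b)
left* = gmap _ left

right* : ∀ {a b b′} → Star _↝_ b b′ → Star _↝_ (fork a b) (fork a b′)
right* = gmap _ right

≡⇒* : ∀ {s t} → s ≡ t → Star _↝_ s t
≡⇒* refl = ε

lcomb-mono : ∀ {s t} us → Star _↝_ s t → Star _↝_ (lcomb s us) (lcomb t us)
lcomb-mono []       p = p
lcomb-mono (u ∷ us) p = lcomb-mono us (left* p)

lcomb-++ : ∀ t us vs → lcomb t (us ++ vs) ≡ lcomb (lcomb t us) vs
lcomb-++ t []       vs = refl
lcomb-++ t (u ∷ us) vs = lcomb-++ (fork t (bottomᵗ u)) us vs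

lcomb-fork : ∀ s t us → Star _↝_ (lcomb (fork s t) us) (fork s (lcomb t us))
lcomb-fork s t []       = ε
lcomb-fork s t (u ∷ us) = lcomb-mono us (rotate ◅ ε) ◅◅ lcomb-fork s (fork t (bottomᵗ u)) us

-- Enlarging a face lowers its bottom and raises its top.
bottomᵗ-anti : ∀ {s t} → s ⇒ t → Star _↝_ (bottomᵗ t) (bottomᵗ s)
lcomb-anti   : ∀ x {ss ts} → ss ⇒ᶠ ts → Star _↝_ (lcomb x ts) (lcomb x ss)
bottomᵗ-anti (node (contract {a} {b} {cs} {ts})) = ≡⇒* (lcomb-++ (fork (bottomᵗ a) (bottomᵗ b)) cs ts)
bottomᵗ-anti (node (here {ts = ts} p))          = lcomb-mono ts (bottomᵗ-anti p)
bottomᵗ-anti (node (there {t = t} p))           = lcomb-anti (bottomᵗ t) p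
lcomb-anti x (contract {a} {b} {cs} {ts}) =
  ≡⇒* (lcomb-++ (fork (fork x (bottomᵗ a)) (bottomᵗ b)) cs ts) ◅◅
  lcomb-mono ts (lcomb-mono cs (rotate ◅ ε) ◅◅ lcomb-fork x (fork (bottomᵗ a) (bottomᵗ b)) cs)
lcomb-anti x (here {ts = ts} p) = lcomb-mono ts (right* (bottomᵗ-anti p))
lcomb-anti x (there {t = t} p)  = lcomb-anti (fork x (bottomᵗ t)) p

rcomb-++ : ∀ b cs d ds → Star _↝_ (fork (rcomb b cs) (rcomb d ds)) (rcomb b (cs ++ d ∷ ds))
rcomb-++ b []       d ds = ε
rcomb-++ b (c ∷ cs) d ds = rotate ◅ right* (rcomb-++ c cs d ds)

topᵗ-mono  : ∀ {s t} → s ⇒ t → Star _↝_ (topᵗ s) (topᵗ t)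
rcomb-mono : ∀ {s ss t ts} → s ∷ ss ⇒ᶠ t ∷ ts → Star _↝_ (rcomb s ss) (rcomb t ts)
topᵗ-mono (node p) = rcomb-mono p
rcomb-mono (contract {a} {b} {cs} {[]})     = ≡⇒* (cong (λ es → fork (topᵗ a) (rcomb b es)) (sym (++-identityʳ cs)))
rcomb-mono (contract {a} {b} {cs} {d ∷ ds}) = rotate ◅ right* (rcomb-++ b cs d ds)
rcomb-mono (here {ts = []} p)               = topᵗ-mono p
rcomb-mono (here {ts = _ ∷ _} p)            = left* (topᵗ-mono p)
rcomb-mono (there p@contract)               = right* (rcomb-mono p)
rcomb-mono (there p@(here _))               = right* (rcomb-mono p)
rcomb-mono (there p@(there _))              = right* (rcomb-mono p)

bottomᵗ-min : ∀ {v t} → Binary v → Star _⇒_ v t → Star _↝_ (bottomᵗ t) v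
bottomᵗ-min v p = anti p ◅◅ ≡⇒* (bottomᵗ-fixed v)
  where
  anti : ∀ {s t} → Star _⇒_ s t → Star _↝_ (bottomᵗ t) (bottomᵗ s)
  anti ε        = ε
  anti (p ◅ ps) = anti ps ◅◅ bottomᵗ-anti p

topᵗ-max : ∀ {v t} → Binary v → Star _⇒_ v t → Star _↝_ v (topᵗ t)
topᵗ-max v p = ≡⇒* (sym (topᵗ-fixed v)) ◅◅ mono p
  where
  mono : ∀ {s t} → Star _⇒_ s t → Star _↝_ (topᵗ s) (topᵗ t)
  mono ε        = ε
  mono (p ◅ ps) = topᵗ-mono p ◅◅ mono ps

edge : ∀ {v t} → Binary v → v ⇒ t →
  (bottomᵗ t ↝ topᵗ t) × (v ≡ bottomᵗ t ⊎ v ≡ topᵗ t)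
edge (bin (bin p q) r) (node contract)
  rewrite bottomᵗ-fixed p | bottomᵗ-fixed q | bottomᵗ-fixed r
        | topᵗ-fixed p | topᵗ-fixed q | topᵗ-fixed r = rotate , inj₁ refl
edge (bin p q) (node (here s)) with edge p s
... | r , v≡ rewrite bottomᵗ-fixed q | topᵗ-fixed q = left r , go v≡
  where
  go : ∀ {v x y b} → v ≡ x ⊎ v ≡ y → fork v b ≡ fork x b ⊎ fork v b ≡ fork y b
  go (inj₁ refl) = inj₁ refl
  go (inj₂ refl) = inj₂ refl
edge (bin p (bin q r)) (node (there contract))
  rewrite bottomᵗ-fixed p | bottomᵗ-fixed q | bottomᵗ-fixed r
        | topᵗ-fixed p | topᵗ-fixed q | topᵗ-fixed r = rotate , inj₂ refl
edge (bin p q) (node (there (here s))) with edge q s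
... | r , v≡ rewrite bottomᵗ-fixed p | topᵗ-fixed p = right r , go v≡
  where
  go : ∀ {v x y a} → v ≡ x ⊎ v ≡ y → fork a v ≡ fork a x ⊎ fork a v ≡ fork a y
  go (inj₁ refl) = inj₁ refl
  go (inj₂ refl) = inj₂ refl

edge⁻ : ∀ {v w} → Binary v → v ↝ w → ∃[ t ] v ⇒ t × bottomᵗ t ≡ v × topᵗ t ≡ w
edge⁻ (bin (bin {a} {b} p q) r) (rotate {c = c}) =
  node a b (c ∷ []) , node contract ,
  cong₂ (λ x y → fork x y) (cong₂ (λ x y → fork x y) (bottomᵗ-fixed p) (bottomᵗ-fixed q)) (bottomᵗ-fixed r) ,
  cong₂ (λ x y → fork x y) (topᵗ-fixed p) (cong₂ (λ x y → fork x y) (topᵗ-fixed q) (topᵗ-fixed r))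
edge⁻ (bin {b = b} p q) (left s) with t , s⇒t , refl , refl ← edge⁻ p s =
  fork t b , node (here s⇒t) ,
  cong (λ x → fork (bottomᵗ t) x) (bottomᵗ-fixed q) , cong (λ x → fork (topᵗ t) x) (topᵗ-fixed q)
edge⁻ (bin {a = a} p q) (right s) with t , s⇒t , refl , refl ← edge⁻ q s =
  fork a t , node (there (here s⇒t)) ,
  cong (λ x → fork x (bottomᵗ t)) (bottomᵗ-fixed p) , cong (λ x → fork x (topᵗ t)) (topᵗ-fixed p)

total : List ℕ → ℕ
total []       = 0
total (x ∷ xs) = x + total xs

total-++ : ∀ xs ys → total (xs ++ ys) ≡ total xs + total ys
total-++ [] ys = refl
total-++ (x ∷ xs) ys rewrite total-++ xs ys = sym (ℕₚ.+-assoc x (total xs) (total ys))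

functional-++ : ∀ xs ys →
  functional (xs ++ ys) ≡ functional xs + length ys * total xs + functional ys
functional-++ [] ys rewrite ℕₚ.*-zeroʳ (length ys) = refl
functional-++ (x ∷ xs) ys rewrite functional-++ xs ys | length-++ xs {ys} =
  lemma (length xs) (length ys) x (functional xs) (total xs) (functional ys)
  where
  lemma : ∀ l m x f s g →
    suc (l + m) * x + (f + m * s + g) ≡ suc l * x + f + m * (x + s) + g
  lemma = solve-∀

record LodayStep (s t : Tree) : Set where
  field
    length≡     : length (loday s) ≡ length (loday t)
    total≡      : total (loday s) ≡ total (loday t)
    functional< : functional (loday s) < functional (loday t)

loday-↝ : ∀ {s t} → s ↝ t → LodayStep s t
loday-↝ (rotate {a} {b} {c}) = record
  { length≡ = len ; total≡ = tot ; functional< = fun }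
  where
  A = loday a
  B = loday b
  C = loday c

  len : length ((A ++ leaves a * leaves b ∷ B) ++ leaves (fork a b) * leaves c ∷ C)
      ≡ length (A ++ leaves a * leaves (fork b c) ∷ B ++ leaves b * leaves c ∷ C)
  len rewrite length-++ (A ++ leaves a * leaves b ∷ B) {leaves (fork a b) * leaves c ∷ C}
            | length-++ A {leaves a * leaves b ∷ B}
            | length-++ A {leaves a * leaves (fork b c) ∷ B ++ leaves b * leaves c ∷ C}
            | length-++ B {leaves b * leaves c ∷ C} =
    ℕₚ.+-assoc (length A) (suc (length B)) (suc (length C))

  tot : total ((A ++ leaves a * leaves b ∷ B) ++ leaves (fork a b) * leaves c ∷ C)
      ≡ total (A ++ leaves a * leaves (fork b c) ∷ B ++ leaves b * leaves c ∷ C)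
  tot rewrite total-++ (A ++ leaves a * leaves b ∷ B) (leaves (fork a b) * leaves c ∷ C)
            | total-++ A (leaves a * leaves b ∷ B)
            | total-++ A (leaves a * leaves (fork b c) ∷ B ++ leaves b * leaves c ∷ C)
            | total-++ B (leaves b * leaves c ∷ C) =
    lemma (total A) (total B) (total C) (leaves a) (leaves b) (leaves c)
    where
    lemma : ∀ tA tB tC a b c →
      tA + (a * b + tB) + ((a + (b + 0)) * c + tC) ≡
      tA + (a * (b + (c + 0)) + (tB + (b * c + tC)))
    lemma = solve-∀

  gap : ℕ
  gap = leaves a * leaves c * suc (length B)

  gap>0 : 0 < gap
  gap>0 = ℕₚ.*-mono-≤ (ℕₚ.*-mono-≤ (leaves>0 a) (leaves>0 c)) (s≤s (z≤n {length B}))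

  fun≡ : functional (A ++ leaves a * leaves (fork b c) ∷ B ++ leaves b * leaves c ∷ C)
       ≡ functional ((A ++ leaves a * leaves b ∷ B) ++ leaves (fork a b) * leaves c ∷ C) + gap
  fun≡ rewrite functional-++ (A ++ leaves a * leaves b ∷ B) (leaves (fork a b) * leaves c ∷ C)
             | functional-++ A (leaves a * leaves b ∷ B)
             | total-++ A (leaves a * leaves b ∷ B)
             | functional-++ A (leaves a * leaves (fork b c) ∷ B ++ leaves b * leaves c ∷ C)
             | functional-++ B (leaves b * leaves c ∷ C)
             | length-++ B {leaves b * leaves c ∷ C} =
    lemma (total A) (total B) (functional A) (functional B) (functional C)
          (length B) (length C) (leaves a) (leaves b) (leaves c)
    where
    lemma : ∀ tA tB fA fB fC lB lC a b c →
      fA + suc (lB + suc lC) * tA +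
        (suc (lB + suc lC) * (a * (b + (c + 0))) + (fB + suc lC * tB + (suc lC * (b * c) + fC))) ≡
      fA + suc lB * tA + (suc lB * (a * b) + fB) + suc lC * (tA + (a * b + tB)) +
        (suc lC * ((a + (b + 0)) * c) + fC) + a * c * suc lB
    lemma = solve-∀

  fun : functional ((A ++ leaves a * leaves b ∷ B) ++ leaves (fork a b) * leaves c ∷ C)
      < functional (A ++ leaves a * leaves (fork b c) ∷ B ++ leaves b * leaves c ∷ C)
  fun rewrite fun≡ = ℕₚ.m<m+n _ gap>0
loday-↝ (left {a} {a′} {b} p) = record
  { length≡ = len ; total≡ = tot ; functional< = fun }
  where
  open LodayStep (loday-↝ p)
  R  = leaves a * leaves b ∷ loday b
  R′ = leaves a′ * leaves b ∷ loday b

  R≡ : R ≡ R′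
  R≡ = cong (λ l → l * leaves b ∷ loday b) (leaves-↝ p)

  len : length (loday a ++ R) ≡ length (loday a′ ++ R′)
  len rewrite R≡ | length-++ (loday a) {R′} | length-++ (loday a′) {R′} | length≡ = refl

  tot : total (loday a ++ R) ≡ total (loday a′ ++ R′)
  tot rewrite R≡ | total-++ (loday a) R′ | total-++ (loday a′) R′ | total≡ = refl

  fun : functional (loday a ++ R) < functional (loday a′ ++ R′)
  fun rewrite R≡ | functional-++ (loday a) R′ | functional-++ (loday a′) R′ | total≡ =
    ℕₚ.+-monoˡ-< _ (ℕₚ.+-monoˡ-< _ functional<)
loday-↝ (right {a} {b} {b′} p) = record
  { length≡ = len ; total≡ = tot ; functional< = fun }
  where
  open LodayStep (loday-↝ p)
  x = leaves a * leaves b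
  x′ = leaves a * leaves b′

  x≡ : x ≡ x′
  x≡ = cong (_*_ (leaves a)) (leaves-↝ p)

  len : length (loday a ++ x ∷ loday b) ≡ length (loday a ++ x′ ∷ loday b′)
  len rewrite length-++ (loday a) {x ∷ loday b} | length-++ (loday a) {x′ ∷ loday b′} | length≡ = refl

  tot : total (loday a ++ x ∷ loday b) ≡ total (loday a ++ x′ ∷ loday b′)
  tot rewrite x≡ | total-++ (loday a) (x′ ∷ loday b) | total-++ (loday a) (x′ ∷ loday b′) | total≡ = refl

  fun : functional (loday a ++ x ∷ loday b) < functional (loday a ++ x′ ∷ loday b′)
  fun rewrite x≡ | functional-++ (loday a) (x′ ∷ loday b)
            | functional-++ (loday a) (x′ ∷ loday b′) | length≡ =
    ℕₚ.+-monoʳ-< (functional (loday a) + suc (length (loday b′)) * total (loday a))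
                 (ℕₚ.+-monoʳ-< (suc (length (loday b′)) * x′) functional<)

forestsOf : List Tree → ℕ → List (List Tree)
forestsOf T zero    = [] ∷ []
forestsOf T (suc l) = [] ∷ cartesianProductWith _∷_ T (forestsOf T l)

-- Contains, among others, all trees with at most m leaves.
trees : ℕ → List Tree
trees zero    = []
trees (suc m) =
  leaf ∷ cartesianProductWith (λ (f : List Tree → Tree) cs → f cs)
           (cartesianProductWith Tree.node (trees m) (trees m)) (forestsOf (trees m) m)

∈-forestsOf : ∀ {T} l {ts} → All (_∈ T) ts → length ts ≤ l → ts ∈ forestsOf T l
∈-forestsOf zero    []       _       = here refl
∈-forestsOf (suc l) []       _       = here refl
∈-forestsOf (suc l) (p ∷ ps) (s≤s q) =
  there (∈-cartesianProductWith⁺ _∷_ p (∈-forestsOf l ps q))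

length≤leavesᶠ : ∀ ts → length ts ≤ leavesᶠ ts
length≤leavesᶠ []       = z≤n
length≤leavesᶠ (t ∷ ts) = ℕₚ.+-mono-≤ (leaves>0 t) (length≤leavesᶠ ts)

∈-trees  : ∀ m t → leaves t ≤ m → t ∈ trees m
∈-treesᶠ : ∀ m ts → leavesᶠ ts ≤ m → All (_∈ trees m) ts
∈-trees zero t p = ⊥-elim (ℕₚ.<⇒≱ (leaves>0 t) p)
∈-trees (suc m) leaf p = here refl
∈-trees (suc m) (node a b cs) p = there (∈-cartesianProductWith⁺ (λ (f : List Tree → Tree) cs → f cs)
  (∈-cartesianProductWith⁺ Tree.node (∈-trees m a a≤) (∈-trees m b b≤))
  (∈-forestsOf m (∈-treesᶠ m cs cs≤) (ℕₚ.≤-trans (length≤leavesᶠ cs) cs≤)))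
  where
  bcs≤ : leaves b + leavesᶠ cs ≤ m
  bcs≤ = ℕₚ.≤-pred (ℕₚ.≤-trans (ℕₚ.+-monoˡ-≤ _ (leaves>0 a)) p)
  a≤ : leaves a ≤ m
  a≤ = ℕₚ.≤-pred (ℕₚ.≤-trans
    (ℕₚ.≤-trans (ℕₚ.≤-reflexive (ℕₚ.+-comm 1 (leaves a)))
                (ℕₚ.+-monoʳ-≤ (leaves a) (ℕₚ.≤-trans (leaves>0 b) (ℕₚ.m≤m+n _ (leavesᶠ cs))))) p)
  b≤ : leaves b ≤ m
  b≤ = ℕₚ.≤-trans (ℕₚ.m≤m+n _ _) bcs≤
  cs≤ : leavesᶠ cs ≤ m
  cs≤ = ℕₚ.≤-trans (ℕₚ.m≤n+m _ (leaves b)) bcs≤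
∈-treesᶠ m []       p = []
∈-treesᶠ m (t ∷ ts) p =
  ∈-trees m t (ℕₚ.≤-trans (ℕₚ.m≤m+n _ _) p) ∷ ∈-treesᶠ m ts (ℕₚ.≤-trans (ℕₚ.m≤n+m _ (leaves t)) p)

select : ∀ n → List Tree → List (TreeWith n)
select n [] = []
select n (t ∷ ts) with leaves t ≟ 2 + n
... | yes p = (t , p) ∷ select n ts
... | no  _ = select n ts

∈-select : ∀ {n ts} (F : TreeWith n) → proj₁ F ∈ ts → F ∈ select n ts
∈-select {n} {t ∷ ts} F t∈ with leaves t ≟ 2 + n | t∈
... | yes p | here eq  = here (TreeWith-≡ eq)
... | yes p | there t∈ = there (∈-select F t∈)
... | no ¬p | here refl = ⊥-elim (¬p (proj₂ F))
... | no ¬p | there t∈ = ∈-select F t∈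

BinaryTreeWith : ℕ → Set
BinaryTreeWith n = Σ[ F ∈ TreeWith n ] treeDim F ≡ 0

underlying : ∀ {n} → BinaryTreeWith n → Tree
underlying v = proj₁ (proj₁ v)

isBinary : ∀ {n} (v : BinaryTreeWith n) → Binary (underlying v)
isBinary (F , p) = toBinary (proj₁ F) (trans (sym (treeDim≡defect F)) p)

mkBinary : ∀ {n} t → Binary t → leaves t ≡ 2 + n → BinaryTreeWith n
mkBinary t b p = (t , p) , trans (treeDim≡defect (t , p)) (fromBinary b)

BinaryTreeWith-≡ : ∀ {n} {v w : BinaryTreeWith n} → underlying v ≡ underlying w → v ≡ w
BinaryTreeWith-≡ {v = (_ , p) , q} {(_ , p′) , q′} refl
  with refl ← ℕₚ.≡-irrelevant p p′ = cong (_ ,_) (ℕₚ.≡-irrelevant q q′)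

lift-↝* : ∀ {n} (v w : BinaryTreeWith n) → Star _↝_ (underlying v) (underlying w) →
  Star (λ v w → underlying v ↝ underlying w) v w
lift-↝* v w p = go p v w refl refl
  where
  go : ∀ {n s t} → Star _↝_ s t → (v w : BinaryTreeWith n) → underlying v ≡ s → underlying w ≡ t →
       Star (λ v w → underlying v ↝ underlying w) v w
  go ε v w refl eq with refl ← BinaryTreeWith-≡ {v = v} {w} (sym eq) = ε
  go (r ◅ rs) v w refl eq =
    _◅_ {j = mkBinary _ (Binary-↝ r (isBinary v)) (trans (sym (leaves-↝ r)) (proj₂ (proj₁ v)))}
        r (go rs _ w refl eq)

-- The n-dimensional associahedron K(n + 2): faces are trees with n + 2 leaves,
-- F ⊆ G when contracting inner edges of F gives G, and the arrows between
-- vertices are the right rotations.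
associahedron : ℕ → OrientedPolytope
associahedron n = record
  { Face           = TreeWith n
  ; _⊆_            = λ F G → Star _⇒_ (proj₁ F) (proj₁ G)
  ; isPartialOrder = record
    { isPreorder = record
      { isEquivalence = isEquivalence
      ; reflexive     = λ { refl → ε }
      ; trans         = _◅◅_
      }
    ; antisym = λ p q → TreeWith-≡ (⇒*-antisym p q)
    }
  ; finite         = select n (trees (2 + n)) ,
                     λ F → ∈-select F (∈-trees (2 + n) (proj₁ F) (ℕₚ.≤-reflexive (proj₂ F)))
  ; whole          = corolla n , cong (_+_ 2) (leaves-replicate n)
  ; ⊆-whole        = λ F → to-corolla (proj₁ F) (proj₂ F)
  ; dim            = treeDim
  ; dim-strict     = dim-strict
  ; _⟶_            = λ v w → underlying v ↝ underlying w
  ; ψ              = λ v → functional (loday (underlying v))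
  ; ψ-strict       = λ r → LodayStep.functional< (loday-↝ r)
  ; bottom         = bottom
  ; top            = top
  ; bottom-⊆       = λ F → bottomᵗ-⇒* (proj₁ F)
  ; top-⊆          = λ F → topᵗ-⇒* (proj₁ F)
  ; bottom-min     = λ {F} v p → lift-↝* (bottom F) v (bottomᵗ-min (isBinary v) p)
  ; top-max        = λ {F} v p → lift-↝* v (top F) (topᵗ-max (isBinary v) p)
  ; edge-⟶         = λ {F} d → proj₁ (edge (bottomᵗ-Binary (proj₁ F)) (step F d (bottom F) (bottomᵗ-⇒* (proj₁ F))))
  ; edge-vertices  = edge-vertices
  ; ⟶-edge         = ⟶-edge
  }
  where
  bottom top : TreeWith n → BinaryTreeWith n
  bottom (t , p) = mkBinary (bottomᵗ t) (bottomᵗ-Binary t) (trans (leaves-⇒* (bottomᵗ-⇒* t)) p)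
  top    (t , p) = mkBinary (topᵗ t) (topᵗ-Binary t) (trans (leaves-⇒* (topᵗ-⇒* t)) p)

  dim-strict : ∀ {F G : TreeWith n} → Star _⇒_ (proj₁ F) (proj₁ G) → F ≢ G → treeDim F < treeDim G
  dim-strict {F} {G} p F≢G with defect-⇒* p
  ... | inj₁ eq = ⊥-elim (F≢G (TreeWith-≡ eq))
  ... | inj₂ lt rewrite treeDim≡defect F | treeDim≡defect G = lt

  -- A vertex of an edge is obtained by expanding the edge in a single step.
  step : ∀ F → treeDim F ≡ 1 → (v : BinaryTreeWith n) →
         Star _⇒_ (underlying v) (proj₁ F) → underlying v ⇒ proj₁ F
  step F d v p = go p (trans (sym (treeDim≡defect F)) d) (fromBinary (isBinary v))
    where
    go : ∀ {s t} → Star _⇒_ s t → defect t ≡ 1 → defect s ≡ 0 → s ⇒ t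
    go ε d e with () ← trans (sym d) e
    go (_◅_ {j = u} r rs) d e with defect-⇒* rs
    ... | inj₁ refl = r
    ... | inj₂ lt rewrite d | defect-⇒ r with s≤s () ← lt

  edge-vertices : ∀ {F} → treeDim F ≡ 1 → (v : BinaryTreeWith n) →
    Star _⇒_ (underlying v) (proj₁ F) → v ≡ bottom F ⊎ v ≡ top F
  edge-vertices {F} d v p with proj₂ (edge (isBinary v) (step F d v p))
  ... | inj₁ eq = inj₁ (BinaryTreeWith-≡ eq)
  ... | inj₂ eq = inj₂ (BinaryTreeWith-≡ eq)

  ⟶-edge : ∀ {v w : BinaryTreeWith n} → underlying v ↝ underlying w →
    ∃[ F ] treeDim F ≡ 1 × bottom F ≡ v × top F ≡ w
  ⟶-edge {v} r with t , s , eq , eq′ ← edge⁻ (isBinary v) r =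
    F , trans (treeDim≡defect F) (trans (defect-⇒ s) (cong suc (fromBinary (isBinary v)))) ,
    BinaryTreeWith-≡ eq , BinaryTreeWith-≡ eq′
    where
    F : TreeWith n
    F = t , trans (sym (leaves-⇒ s)) (proj₂ (proj₁ v))

associahedra : Family
associahedra = record
  { member     = λ n → associahedron n
  ; dimension≡ = λ n → cong (n ∸_) (no-inner n)
  }
  where
  no-inner : ∀ n → innerVerticesᶠ (replicate n leaf) ≡ 0
  no-inner zero    = refl
  no-inner (suc n) = no-inner n

{-# OPTIONS --safe #-}
module Submission where

-- In a binary tree with n + 2 leaves call a leaf left- or right-leaning
-- according to the side on which it hangs.  Rotations never decrease the number
-- of left-leaning leaves.  A face F has more than dim F left-leaning leaves in
-- its top vertex and more than dim F right-leaning leaves in its bottom vertex,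
-- so F ≼ G gives dim F + dim G ≤ n.  This is 2-shortness, and it bounds the sum
-- of the dimensions of a face chain of length k ≥ 2 by k n / 2.  Conversely,
-- nested ternary vertices whose outer children are leaves give, for fixed k and
-- large n, chains of k faces each of dimension n / 2 - O(k).  The minimum excess
-- exists because the Tamari order is decidable, and it differs from
-- n - k n / 2 by a quantity that is bounded in n.

open import Defs
open import Data.Integer.Base as ℤ using (ℤ; +_; -[1+_])
import Data.Integer.Properties as ℤₚ
import Data.Integer.Tactic.RingSolver as ℤ-Solver
open import Data.List.Base using (List; []; _∷_; _++_; map; filter; replicate; cartesianProductWith)
import Data.List.Extrema ℤₚ.≤-totalOrder as Extrema
open import Data.List.Membership.Propositional using (_∈_)
open import Data.List.Membership.Propositional.Properties using (∈-cartesianProductWith⁺; ∈-filter⁺)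
import Data.List.Relation.Unary.All as All
open import Data.List.Relation.Unary.All.Properties using (all-filter)
open import Data.List.Relation.Unary.Any as Any using (Any; here; any?)
open import Data.List.Relation.Unary.Any.Properties using (++⁺ˡ; ++⁺ʳ; map⁺)
open import Data.Nat.Base using (ℕ; zero; suc; _+_; _*_; _∸_; _≤_; _<_; z≤n; s≤s; NonZero)
open import Data.Nat.DivMod using (_/_; _%_; m≡m%n+[m/n]*n; m%n<n)
import Data.Nat.Properties as ℕₚ
open import Data.Nat.Tactic.RingSolver using (solve-∀)
open import Data.Product.Base using (∃; ∃-syntax; _×_; _,_; proj₁; proj₂)
open import Data.Rational.Base as ℚ using (ℚ; 0ℚ; 1ℚ; ½; ↧ₙ_; mkℚ; toℚᵘ; fromℚᵘ)
import Data.Rational.Properties as ℚₚ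
open import Data.Rational.Unnormalised.Base as ℚᵘ using (mkℚᵘ)
import Data.Rational.Unnormalised.Properties as ℚᵘₚ
open import Data.Vec.Base as Vec using (Vec; []; _∷_)
open import Data.Vec.Relation.Unary.Linked using (Linked; []; [-]; _∷_; linked?)
open import Relation.Binary.Construct.Closure.ReflexiveTransitive using (Star; ε; _◅_; _◅◅_; gmap)
open import Relation.Binary.Definitions using (Decidable; DecidableEquality)
open import Relation.Binary.PropositionalEquality
  using (_≡_; refl; sym; trans; cong; cong₂; subst; subst₂; module ≡-Reasoning)
open import Relation.Nullary using (Dec; yes; no; contradiction)
open import Relation.Nullary.Decidable using (map′; _×-dec_)

-- Leaning leaves and 2-shortness

-- The argument x is the count for the tree that is a single leaf.
leftLeaning rightLeaning : ℕ → Tree → ℕ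
leftLeaning x leaf         = x
leftLeaning x (node a b _) = leftLeaning 1 a + leftLeaning 0 b
rightLeaning x leaf         = x
rightLeaning x (node a b _) = rightLeaning 0 a + rightLeaning 1 b

leftLeaning-mono : ∀ {x y} t → x ≤ y → leftLeaning x t ≤ leftLeaning y t
leftLeaning-mono leaf         p = p
leftLeaning-mono (node _ _ _) p = ℕₚ.≤-refl

rightLeaning-mono : ∀ {x y} t → x ≤ y → rightLeaning x t ≤ rightLeaning y t
rightLeaning-mono leaf         p = p
rightLeaning-mono (node _ _ _) p = ℕₚ.≤-refl

-- Every leaf leans exactly one way. The hypothesis on `x` and `y` makes a tree that is a single
-- leaf count once in total, whichever side it hangs on.
left+right≡leaves : ∀ {t x y} → Binary t → x + y ≡ 1 → leftLeaning x t + rightLeaning y t ≡ leaves t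
left+right≡leaves leaf p = p
left+right≡leaves (bin {a} {b} p q) _ =
  trans (lemma (leftLeaning 1 a) (leftLeaning 0 b) (rightLeaning 0 a) (rightLeaning 1 b))
        (cong₂ (λ m n → m + (n + 0)) (left+right≡leaves p refl) (left+right≡leaves q refl))
  where
  lemma : ∀ la lb ra rb → la + lb + (ra + rb) ≡ la + ra + (lb + rb + 0)
  lemma = solve-∀

-- A rotation of ((a b) c) changes the position of b only, from right to left child.
leftLeaning-↝ : ∀ {x s t} → s ↝ t → leftLeaning x s ≤ leftLeaning x t
leftLeaning-↝ (rotate {a} {b} {c}) = begin
  leftLeaning 1 a + leftLeaning 0 b + leftLeaning 0 c   ≡⟨ ℕₚ.+-assoc (leftLeaning 1 a) _ _ ⟩
  leftLeaning 1 a + (leftLeaning 0 b + leftLeaning 0 c)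
    ≤⟨ ℕₚ.+-monoʳ-≤ (leftLeaning 1 a) (ℕₚ.+-monoˡ-≤ _ (leftLeaning-mono b z≤n)) ⟩
  leftLeaning 1 a + (leftLeaning 1 b + leftLeaning 0 c) ∎
  where open ℕₚ.≤-Reasoning
leftLeaning-↝ (left p)          = ℕₚ.+-monoˡ-≤ _ (leftLeaning-↝ p)
leftLeaning-↝ (right {a = a} p) = ℕₚ.+-monoʳ-≤ (leftLeaning 1 a) (leftLeaning-↝ p)

leftLeaning-↝* : ∀ {x s t} → Star _↝_ s t → leftLeaning x s ≤ leftLeaning x t
leftLeaning-↝* ε        = ℕₚ.≤-refl
leftLeaning-↝* (p ◅ ps) = ℕₚ.≤-trans (leftLeaning-↝ p) (leftLeaning-↝* ps)

-- In a right comb every child but the last hangs on the left, and a child there contributes more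
-- than its defect. A vertex with m + 2 children thus gains m + 1: its own defect m and one more,
-- which gives the strict inequality.
defect≤leftLeaning-top    : ∀ t → defect t ≤ leftLeaning 0 (topᵗ t)
defect<leftLeaning-top    : ∀ t → defect t < leftLeaning 1 (topᵗ t)
defect≤leftLeaning-rcomb  : ∀ t us → defect t + defectᶠ us ≤ leftLeaning 0 (rcomb t us)
defect≤leftLeaning-top leaf            = z≤n
defect≤leftLeaning-top t@(node _ _ _)  = ℕₚ.<⇒≤ (defect<leftLeaning-top t)
defect<leftLeaning-top leaf            = ℕₚ.≤-refl
defect<leftLeaning-top (node a b cs)   =
  ℕₚ.+-mono-≤ (defect<leftLeaning-top a) (defect≤leftLeaning-rcomb b cs)
defect≤leftLeaning-rcomb t []       rewrite ℕₚ.+-identityʳ (defect t) = defect≤leftLeaning-top t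
defect≤leftLeaning-rcomb t (u ∷ us) rewrite ℕₚ.+-suc (defect t) (defect u + defectᶠ us) =
  ℕₚ.+-mono-≤ (defect<leftLeaning-top t) (defect≤leftLeaning-rcomb u us)

-- The mirror image: in a left comb every child but the first hangs on the right. As `lcomb`
-- accumulates, its bound speaks of an arbitrary tree `t` built so far.
defect≤rightLeaning-bottom : ∀ t → defect t ≤ rightLeaning 0 (bottomᵗ t)
defect<rightLeaning-bottom : ∀ t → defect t < rightLeaning 1 (bottomᵗ t)
defect<rightLeaning-node   : ∀ a b cs → defect (node a b cs) < rightLeaning 0 (bottomᵗ (node a b cs))
defect≤rightLeaning-lcomb  : ∀ t us → rightLeaning 0 t + defectᶠ us ≤ rightLeaning 0 (lcomb t us)
defect≤rightLeaning-bottom leaf          = z≤n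
defect≤rightLeaning-bottom (node a b cs) = ℕₚ.<⇒≤ (defect<rightLeaning-node a b cs)
defect<rightLeaning-bottom leaf          = ℕₚ.≤-refl
defect<rightLeaning-bottom t@(node a b cs) =
  ℕₚ.≤-trans (defect<rightLeaning-node a b cs) (rightLeaning-mono (bottomᵗ t) z≤n)
defect<rightLeaning-node a b cs = begin
  suc (defect a + (defect b + defectᶠ cs)) ≡⟨ lemma (defect a) (defect b) (defectᶠ cs) ⟩
  defect a + suc (defect b) + defectᶠ cs
    ≤⟨ ℕₚ.+-monoˡ-≤ _ (ℕₚ.+-mono-≤ (defect≤rightLeaning-bottom a) (defect<rightLeaning-bottom b)) ⟩
  rightLeaning 0 (fork (bottomᵗ a) (bottomᵗ b)) + defectᶠ cs ≤⟨ defect≤rightLeaning-lcomb _ cs ⟩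
  rightLeaning 0 (lcomb (fork (bottomᵗ a) (bottomᵗ b)) cs) ∎
  where
  open ℕₚ.≤-Reasoning
  lemma : ∀ a b c → suc (a + (b + c)) ≡ a + suc b + c
  lemma = solve-∀
defect≤rightLeaning-lcomb t []       = ℕₚ.≤-reflexive (ℕₚ.+-identityʳ _)
defect≤rightLeaning-lcomb t (u ∷ us) = begin
  rightLeaning 0 t + suc (defect u + defectᶠ us) ≡⟨ ℕₚ.+-assoc (rightLeaning 0 t) (suc (defect u)) _ ⟨
  rightLeaning 0 t + suc (defect u) + defectᶠ us
    ≤⟨ ℕₚ.+-monoˡ-≤ _ (ℕₚ.+-monoʳ-≤ (rightLeaning 0 t) (defect<rightLeaning-bottom u)) ⟩
  rightLeaning 0 (fork t (bottomᵗ u)) + defectᶠ us ≤⟨ defect≤rightLeaning-lcomb _ us ⟩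
  rightLeaning 0 (lcomb (fork t (bottomᵗ u)) us) ∎
  where open ℕₚ.≤-Reasoning

module _ {n : ℕ} where
  open OrientedPolytope (associahedron n) using (_≼_; _≤ᵥ_; dim)

  underlying-≤ᵥ : ∀ {v w} → v ≤ᵥ w → Star _↝_ (underlying v) (underlying w)
  underlying-≤ᵥ = gmap underlying (λ r → r)

  -- Both counts are compared in the bottom vertex of `G`; the two strict inequalities absorb the 2
  -- in its number of leaves 2 + n.
  dim+dim≤n : ∀ {F G : TreeWith n} → F ≼ G → dim F + dim G ≤ n
  dim+dim≤n {leaf , ()}
  dim+dim≤n {node _ _ _ , _} {leaf , ()}
  dim+dim≤n {F@(s@(node _ _ _) , _)} {G@(t@(node a b cs) , q)} p
    rewrite treeDim≡defect F | treeDim≡defect G = ℕₚ.≤-pred (ℕₚ.≤-pred (begin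
    2 + (defect s + defect t)         ≡⟨ cong suc (ℕₚ.+-suc (defect s) (defect t)) ⟨
    suc (defect s) + suc (defect t)
      ≤⟨ ℕₚ.+-mono-≤ (defect<leftLeaning-top s) (defect<rightLeaning-node a b cs) ⟩
    leftLeaning 1 (topᵗ s) + rightLeaning 0 (bottomᵗ t)
      ≤⟨ ℕₚ.+-monoˡ-≤ _ (leftLeaning-↝* (underlying-≤ᵥ p)) ⟩
    leftLeaning 1 (bottomᵗ t) + rightLeaning 0 (bottomᵗ t)
      ≡⟨ left+right≡leaves (bottomᵗ-Binary t) refl ⟩
    leaves (bottomᵗ t)                ≡⟨ leaves-⇒* (bottomᵗ-⇒* t) ⟩
    leaves t                          ≡⟨ q ⟩
    2 + n                             ∎))
    where open ℕₚ.≤-Reasoning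

-- Existence and bounds of the minimum excess

vecs : ∀ {A : Set} → List A → ∀ k → List (Vec A k)
vecs xs zero    = [] ∷ []
vecs xs (suc k) = cartesianProductWith _∷_ xs (vecs xs k)

∈-vecs : ∀ {A : Set} {xs : List A} → (∀ x → x ∈ xs) → ∀ {k} (v : Vec A k) → v ∈ vecs xs k
∈-vecs all []      = here refl
∈-vecs all (x ∷ v) = ∈-cartesianProductWith⁺ _∷_ (all x) (∈-vecs all v)

module _ (P : OrientedPolytope) where
  open OrientedPolytope P

  dimSum : ∀ {k} → Vec Face k → ℕ
  dimSum v = Vec.sum (Vec.map dim v)

  sumℤ≡dimSum : ∀ {k} (v : Vec Face k) →
    sumℤ (Vec.map (λ F → + dim F ℤ.- + 1) v) ≡ + dimSum v ℤ.- + k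
  sumℤ≡dimSum [] = refl
  sumℤ≡dimSum {suc k} (F ∷ v) rewrite sumℤ≡dimSum v | ℤₚ.pos-+ (dim F) (dimSum v) =
    lemma (+ dim F) (+ dimSum v) (+ k)
    where
    lemma : ∀ d s k → d ℤ.- + 1 ℤ.+ (s ℤ.- k) ≡ d ℤ.+ s ℤ.- (+ 1 ℤ.+ k)
    lemma = ℤ-Solver.solve-∀

  excess≡ : ∀ {k} (c : FaceChain P k) →
    excess P c ≡ + dimension ℤ.+ + k ℤ.- + 1 ℤ.- + dimSum (faces c)
  excess≡ {k} c rewrite sumℤ≡dimSum (faces c) = lemma (+ dimension) (+ k) (+ dimSum (faces c))
    where
    lemma : ∀ n k s → n ℤ.- + 1 ℤ.- (s ℤ.- k) ≡ n ℤ.+ k ℤ.- + 1 ℤ.- s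
    lemma = ℤ-Solver.solve-∀

  bottom≤top : ∀ F → bottom F ≤ᵥ top F
  bottom≤top F = top-max (bottom F) (bottom-⊆ F)

  -- Supplies the pair of the first and the third face when the length is odd.
  ≼-trans : ∀ {F G H} → F ≼ G → G ≼ H → F ≼ H
  ≼-trans {G = G} p q = p ◅◅ bottom≤top G ◅◅ q

  -- Add the bounds for disjoint pairs of neighbours and, when k is odd, for the
  -- three pairs among the last three faces.
  2*dimSum≤ : ∀ {n} → (∀ {F G} → F ≼ G → dim F + dim G ≤ n) →
    ∀ {k} (v : Vec Face (2 + k)) → Linked _≼_ v → 2 * dimSum v ≤ (2 + k) * n
  2*dimSum≤ {n} pair (F ∷ G ∷ []) (p ∷ _) = begin
    2 * (dim F + (dim G + 0)) ≡⟨ cong (λ d → 2 * (dim F + d)) (ℕₚ.+-identityʳ (dim G)) ⟩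
    2 * (dim F + dim G)       ≤⟨ ℕₚ.*-monoʳ-≤ 2 (pair p) ⟩
    2 * n                     ∎
    where open ℕₚ.≤-Reasoning
  2*dimSum≤ {n} pair (F ∷ G ∷ H ∷ []) (p ∷ q ∷ _) = begin
    2 * (dim F + (dim G + (dim H + 0)))               ≡⟨ lemma (dim F) (dim G) (dim H) ⟩
    (dim F + dim G) + ((dim G + dim H) + (dim F + dim H))
      ≤⟨ ℕₚ.+-mono-≤ (pair p) (ℕₚ.+-mono-≤ (pair q) (pair (≼-trans {F} {G} {H} p q))) ⟩
    n + (n + n)                                       ≡⟨ cong (λ m → n + (n + m)) (ℕₚ.+-identityʳ n) ⟨
    3 * n                                             ∎
    where
    open ℕₚ.≤-Reasoning
    lemma : ∀ f g h → 2 * (f + (g + (h + 0))) ≡ (f + g) + ((g + h) + (f + h))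
    lemma = solve-∀
  2*dimSum≤ {n} pair {suc (suc k)} (F ∷ G ∷ v@(_ ∷ _ ∷ _)) (p ∷ _ ∷ l) = begin
    2 * (dim F + (dim G + dimSum v))          ≡⟨ lemma (dim F) (dim G) (dimSum v) ⟩
    2 * (dim F + dim G) + 2 * dimSum v        ≤⟨ ℕₚ.+-mono-≤ (ℕₚ.*-monoʳ-≤ 2 (pair p)) (2*dimSum≤ pair v l) ⟩
    2 * n + (2 + k) * n                       ≡⟨ ℕₚ.*-distribʳ-+ n 2 (2 + k) ⟨
    (4 + k) * n                               ∎
    where
    open ℕₚ.≤-Reasoning
    lemma : ∀ f g s → 2 * (f + (g + s)) ≡ 2 * (f + g) + 2 * s
    lemma = solve-∀

  -- Exhaustive search: there are finitely many vectors of faces, and being a chain is decidable.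
  -- The chain `c₀` is the default value of the minimum.
  minimal-chain : ∀ {k} → Decidable _≼_ → FaceChain P k →
    ∃[ c ] (∀ (d : FaceChain P k) → excess P c ℤ.≤ excess P d)
  minimal-chain {k} _≼?_ c₀ =
    faceChain v (Extrema.argmin-all exc (linked c₀) (all-filter (linked? _≼?_) (vecs Fs k))) ,
    λ d → All.lookup (Extrema.f[argmin]≤f[xs] (faces c₀) chains)
            (∈-filter⁺ (linked? _≼?_) (∈-vecs (proj₂ finite) (faces d)) (linked d))
    where
    Fs : List Face
    Fs = proj₁ finite
    exc : Vec Face k → ℤ
    exc v = (+ dimension ℤ.- + 1) ℤ.- sumℤ (Vec.map (λ F → + dim F ℤ.- + 1) v)
    chains : List (Vec Face k)
    chains = filter (linked? _≼?_) (vecs Fs k)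
    v : Vec Face k
    v = Extrema.argmin exc (faces c₀) chains

-- Decidability of the Tamari order

module _ {A : Set} {R : A → A → Set} (_≟_ : DecidableEquality A)
         (ψ : A → ℕ) (ψ-strict : ∀ {x y} → R x y → ψ x < ψ y)
         (succs : ∀ x → List (∃ (R x))) (complete : ∀ {x y} → R x y → Any (λ z → y ≡ proj₁ z) (succs x))
  where

  ψ-mono : ∀ {x y} → Star R x y → ψ x ≤ ψ y
  ψ-mono ε        = ℕₚ.≤-refl
  ψ-mono (r ◅ rs) = ℕₚ.≤-trans (ℕₚ.<⇒≤ (ψ-strict r)) (ψ-mono rs)

  -- Searches through the successors. Every arrow raises `ψ`, so a path from `x` to `y` has at most
  -- ψ y - ψ x arrows, and `fuel` is kept at least that large.
  star? : Decidable (Star R)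
  star? x y = go (ψ y) x y (ℕₚ.m≤m+n (ψ y) (ψ x))
    where
    go : ∀ fuel x y → ψ y ≤ fuel + ψ x → Dec (Star R x y)
    go fuel x y p with x ≟ y
    ... | yes refl = yes ε
    -- Without fuel ψ y ≤ ψ x, so any first arrow would already overshoot `y`.
    go zero x y p | no x≢y = no λ
      { ε        → x≢y refl
      ; (r ◅ rs) → ℕₚ.<⇒≱ (ψ-strict r) (ℕₚ.≤-trans (ψ-mono rs) p) }
    go (suc fuel) x y p | no x≢y =
      map′ (λ a → let z , rs = Any.satisfied a in proj₂ z ◅ rs)
           (λ { ε → contradiction refl x≢y
              ; (r ◅ rs) → Any.map (λ eq → subst (λ z → Star R z y) eq rs) (complete r) })
           (any? {P = λ z → Star R (proj₁ z) y} (λ z → go fuel (proj₁ z) y (step (proj₂ z))) (succs x))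
      where
      step : ∀ {z} → R x z → ψ y ≤ fuel + ψ z
      step {z} r = begin
        ψ y              ≤⟨ p ⟩
        suc fuel + ψ x   ≡⟨ ℕₚ.+-suc fuel (ψ x) ⟨
        fuel + suc (ψ x) ≤⟨ ℕₚ.+-monoʳ-≤ fuel (ψ-strict r) ⟩
        fuel + ψ z       ∎
        where open ℕₚ.≤-Reasoning

infix 4 _≟ᵗ_ _≟ᶠ_
_≟ᵗ_ : DecidableEquality Tree
_≟ᶠ_ : DecidableEquality (List Tree)
leaf       ≟ᵗ leaf       = yes refl
leaf       ≟ᵗ node _ _ _ = no λ ()
node _ _ _ ≟ᵗ leaf       = no λ ()
node a b c ≟ᵗ node d e f =
  map′ (λ { (refl , refl , refl) → refl }) (λ { refl → refl , refl , refl })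
       (a ≟ᵗ d ×-dec b ≟ᵗ e ×-dec c ≟ᶠ f)
[]       ≟ᶠ []       = yes refl
[]       ≟ᶠ (_ ∷ _)  = no λ ()
(_ ∷ _)  ≟ᶠ []       = no λ ()
(s ∷ ss) ≟ᶠ (t ∷ ts) =
  map′ (λ { (refl , refl) → refl }) (λ { refl → refl , refl }) (s ≟ᵗ t ×-dec ss ≟ᶠ ts)

rootRotations rotations : ∀ t → List (∃ (t ↝_))
rootRotations (fork (fork a b) c) = (_ , rotate) ∷ []
rootRotations _                   = []
rotations t@(fork a b) =
  rootRotations t ++
  (map (λ (_ , r) → _ , left r) (rotations a) ++ map (λ (_ , r) → _ , right r) (rotations b))
rotations _ = []

rotations-complete : ∀ {s t} → s ↝ t → Any (λ u → t ≡ proj₁ u) (rotations s)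
rotations-complete rotate = here refl
rotations-complete (left {a} {b = b} r) =
  ++⁺ʳ (rootRotations (fork a b)) (++⁺ˡ (map⁺ (Any.map (cong (λ t → fork t b)) (rotations-complete r))))
rotations-complete (right {a} {b} r) =
  ++⁺ʳ (rootRotations (fork a b)) (++⁺ʳ (map _ (rotations a))
    (map⁺ (Any.map (cong (λ t → fork a t)) (rotations-complete r))))

_↝*?_ : Decidable (Star _↝_)
_↝*?_ = star? _≟ᵗ_ (λ t → functional (loday t)) (λ r → LodayStep.functional< (loday-↝ r))
              rotations rotations-complete

module _ {n : ℕ} where
  open OrientedPolytope (associahedron n) using (_≼_; bottom; top)

  ≼⁺ : ∀ {F G : TreeWith n} → Star _↝_ (topᵗ (proj₁ F)) (bottomᵗ (proj₁ G)) → F ≼ G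
  ≼⁺ {F} {G} = lift-↝* (top F) (bottom G)

  _≼?_ : Decidable _≼_
  F ≼? G = map′ (≼⁺ {F} {G}) underlying-≤ᵥ (topᵗ (proj₁ F) ↝*? bottomᵗ (proj₁ G))

-- Long chains of large faces

-- Accumulating, so that `lefts (suc i) t` reduces to `lefts i (fork leaf t)`; this is how one face
-- hands a left leaf to the spine of the next.
lefts : ℕ → Tree → Tree
lefts zero    t = t
lefts (suc i) t = lefts i (fork leaf t)

leaves-lefts : ∀ i t → leaves (lefts i t) ≡ i + leaves t
leaves-lefts zero    t = refl
leaves-lefts (suc i) t = trans (leaves-lefts i (fork leaf t)) (lemma i (leaves t))
  where
  lemma : ∀ i l → i + (1 + (l + 0)) ≡ suc i + l
  lemma = solve-∀

defect-lefts : ∀ i t → defect (lefts i t) ≡ defect t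
defect-lefts zero    t = refl
defect-lefts (suc i) t = trans (defect-lefts i (fork leaf t)) (ℕₚ.+-identityʳ (defect t))

topᵗ-lefts : ∀ i t → topᵗ (lefts i t) ≡ lefts i (topᵗ t)
topᵗ-lefts zero    t = refl
topᵗ-lefts (suc i) t = topᵗ-lefts i (fork leaf t)

bottomᵗ-lefts : ∀ i t → bottomᵗ (lefts i t) ≡ lefts i (bottomᵗ t)
bottomᵗ-lefts zero    t = refl
bottomᵗ-lefts (suc i) t = bottomᵗ-lefts i (fork leaf t)

Binary-lefts : ∀ i {t} → Binary t → Binary (lefts i t)
Binary-lefts zero    p = p
Binary-lefts (suc i) p = Binary-lefts i (bin leaf p)

-- Each layer uses two leaves and adds one to the defect, so about half of the leaves turn into
-- dimension, the share that `dim+dim≤n` allows on average.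
zigzag : ℕ → Tree → Tree
zigzag zero    c = c
zigzag (suc l) c = node leaf (zigzag l c) (leaf ∷ [])

leaves-zigzag : ∀ l c → leaves (zigzag l c) ≡ 2 * l + leaves c
leaves-zigzag zero    c = refl
leaves-zigzag (suc l) c = trans (cong (λ m → 1 + (m + 1)) (leaves-zigzag l c)) (lemma l (leaves c))
  where
  lemma : ∀ l c → 1 + (2 * l + c + 1) ≡ 2 * suc l + c
  lemma = solve-∀

l≤defect-zigzag : ∀ l c → l ≤ defect (zigzag l c)
l≤defect-zigzag zero    c = z≤n
l≤defect-zigzag (suc l) c =
  ℕₚ.≤-trans (ℕₚ.≤-reflexive (ℕₚ.+-comm 1 l)) (ℕₚ.+-monoˡ-≤ 1 (l≤defect-zigzag l c))

-- Let L and R attach a leaf on the left and on the right. A layer has bottom RL and top LR, and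
-- (RL)ˡ R = R (LR)ˡ by moving the brackets one letter.
bottomᵗ-zigzag : ∀ l {c} → Binary c → bottomᵗ (zigzag l (fork c leaf)) ≡ fork (topᵗ (zigzag l c)) leaf
bottomᵗ-zigzag zero    p =
  cong (λ c → fork c leaf) (trans (bottomᵗ-fixed p) (sym (topᵗ-fixed p)))
bottomᵗ-zigzag (suc l) p = cong (λ t → fork (fork leaf t) leaf) (bottomᵗ-zigzag l p)

-- With L t = fork leaf t and R t = fork t leaf, the top of the face
-- Lⁱ (zigzag (1 + l) c) is Lⁱ (LR)¹⁺ˡ c = Lⁱ⁺¹ (RL)ˡ R c, which is the bottom of
-- the face Lⁱ⁺¹ (zigzag l (R c)).
step : ℕ → ℕ → Tree → Tree
step i l c = lefts i (zigzag l c)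

top-step≡bottom-step : ∀ i l {c} → Binary c →
  topᵗ (step i (suc l) c) ≡ bottomᵗ (step (suc i) l (fork c leaf))
top-step≡bottom-step i l {c} p = begin
  topᵗ (lefts i (zigzag (suc l) c))                       ≡⟨ topᵗ-lefts i _ ⟩
  lefts i (fork leaf (fork (topᵗ (zigzag l c)) leaf))     ≡⟨ cong (λ t → lefts i (fork leaf t)) (bottomᵗ-zigzag l p) ⟨
  lefts (suc i) (bottomᵗ (zigzag l (fork c leaf)))        ≡⟨ bottomᵗ-lefts (suc i) _ ⟨
  bottomᵗ (lefts (suc i) (zigzag l (fork c leaf)))        ∎
  where open ≡-Reasoning

leaves-step : ∀ i l c → leaves (step i l c) ≡ i + (2 * l + leaves c)
leaves-step i l c = trans (leaves-lefts i _) (cong (_+_ i) (leaves-zigzag l c))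

module _ {n : ℕ} where
  open OrientedPolytope (associahedron n) using (_≼_; dim)

  -- From each face to the next one layer is given up: one of its two leaves goes to the outer
  -- spine, the other to the core. Starting with k + j layers, the last of the k faces still has 1 +
  -- j, so each contributes at least j to the sum of dimensions.
  stairs : ∀ k i j c → i + (2 * (k + j) + leaves c) ≡ 2 + n → Vec (TreeWith n) k
  next   : ∀ k i j c → i + (2 * (suc k + j) + leaves c) ≡ 2 + n →
           suc i + (2 * (k + j) + leaves (fork c leaf)) ≡ 2 + n
  stairs zero    i j c p = []
  stairs (suc k) i j c p =
    (step i (suc k + j) c , trans (leaves-step i (suc k + j) c) p) ∷
    stairs k (suc i) j (fork c leaf) (next k i j c p)
  next k i j c = trans (lemma i (k + j) (leaves c))
    where
    lemma : ∀ i l c → suc i + (2 * l + (c + 1)) ≡ i + (2 * suc l + c)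
    lemma = solve-∀

  stairs-linked : ∀ k i j {c} → Binary c → ∀ p → Linked _≼_ (stairs k i j c p)
  stairs-linked zero          i j b p = []
  stairs-linked (suc zero)    i j b p = [-]
  stairs-linked (suc (suc k)) i j {c} b p =
    ≼⁺ {F = Vec.head (stairs (2 + k) i j c p)}
       {Vec.head (stairs (suc k) (suc i) j (fork c leaf) (next (suc k) i j c p))}
       (≡⇒* (top-step≡bottom-step i (suc k + j) b)) ∷
    stairs-linked (suc k) (suc i) j (bin b leaf) (next (suc k) i j c p)

  dimSum-stairs : ∀ k i j c p → k * j ≤ dimSum (associahedron n) (stairs k i j c p)
  dimSum-stairs zero    i j c p = z≤n
  dimSum-stairs (suc k) i j c p =
    ℕₚ.+-mono-≤ (begin
        j                              ≤⟨ ℕₚ.m≤n+m j (suc k) ⟩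
        suc k + j                      ≤⟨ l≤defect-zigzag (suc k + j) c ⟩
        defect (zigzag (suc k + j) c)  ≡⟨ defect-lefts i _ ⟨
        defect (step i (suc k + j) c)  ≡⟨ treeDim≡defect F ⟨
        dim F                          ∎)
      (dimSum-stairs k (suc i) j (fork c leaf) (next k i j c p))
    where
    open ℕₚ.≤-Reasoning
    F : TreeWith n
    F = step i (suc k + j) c , trans (leaves-step i (suc k + j) c) p

  -- A vertex is its own top and bottom, so it may be repeated. This chain starts the search for the
  -- minimum.
  constant-chain : ∀ k → FaceChain (associahedron n) k
  constant-chain k = faceChain (Vec.replicate k F) (constant-linked k)
    where
    t : Tree
    t = lefts n (fork leaf leaf)
    b : Binary t
    b = Binary-lefts n (bin leaf leaf)
    F : TreeWith n
    F = t , trans (leaves-lefts n _) (ℕₚ.+-comm n 2)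
    constant-linked : ∀ k → Linked _≼_ (Vec.replicate k F)
    constant-linked zero          = []
    constant-linked (suc zero)    = [-]
    constant-linked (suc (suc k)) =
      ≼⁺ {F = F} {F} (≡⇒* (trans (topᵗ-fixed b) (sym (bottomᵗ-fixed b)))) ∷ constant-linked (suc k)

-- Dimension of the associahedron and chains of length one

defectᶠ-replicate : ∀ m → defectᶠ (replicate m leaf) ≡ m
defectᶠ-replicate zero    = refl
defectᶠ-replicate (suc m) = cong suc (defectᶠ-replicate m)

dimension-associahedron : ∀ n → OrientedPolytope.dimension (associahedron n) ≡ n
dimension-associahedron n = trans (treeDim≡defect (OrientedPolytope.whole (associahedron n))) (defectᶠ-replicate n)

≤⇒≤-minus : ∀ {a b c} → a + b ≤ c → + a ℤ.≤ + c ℤ.- + b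
≤⇒≤-minus {a} {b} p =
  ℤₚ.≤-trans (ℤₚ.≤-reflexive (cancel (+ a) (+ b))) (ℤₚ.+-monoˡ-≤ (ℤ.- + b) (ℤ.+≤+ p))
  where
  cancel : ∀ a b → a ≡ a ℤ.+ b ℤ.- b
  cancel = ℤ-Solver.solve-∀

-- Since the polytope itself is excluded, the best face is a facet, here the corolla with its first
-- two leaves split off.
minimal-excess-1 : ∀ m → IsMinExcess (associahedron (suc m)) 1 (+ 1)
minimal-excess-1 m = (facet-chain , (λ ()) , excess-facet) , bound
  where
  P = associahedron (suc m)
  open OrientedPolytope P using (dim; dim-strict; ⊆-whole)

  excess₁ : ∀ (c : FaceChain P 1) → excess P c ≡ + suc m ℤ.- + dimSum P (faces c)
  excess₁ c = trans (excess≡ P c) (cong (ℤ._- + dimSum P (faces c))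
    (trans (cong (λ d → + d ℤ.+ + 1 ℤ.- + 1) (dimension-associahedron (suc m)))
           (cong (λ d → + d ℤ.- + 1) (ℕₚ.+-comm (suc m) 1))))

  facet : TreeWith (suc m)
  facet = node (fork leaf leaf) leaf (replicate m leaf) , cong (_+_ 3) (leaves-replicate m)

  facet-chain : FaceChain P 1
  facet-chain = faceChain (facet ∷ []) [-]

  excess-facet : excess P facet-chain ≡ + 1
  excess-facet = trans (excess₁ facet-chain)
    (trans (cong (λ d → + suc m ℤ.- + d)
             (trans (ℕₚ.+-identityʳ _) (trans (treeDim≡defect facet) (defectᶠ-replicate m))))
           (trans (ℤₚ.m-n≡m⊖n (suc m) m) (trans (ℤₚ.⊖-≥ (ℕₚ.n≤1+n m)) (cong +_ (ℕₚ.m+n∸n≡m 1 m)))))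

  bound : ∀ c → Admissible P c → + 1 ℤ.≤ excess P c
  bound c@(faceChain (F ∷ []) [-]) F≢ = subst (+ 1 ℤ.≤_) (sym (excess₁ c))
    (subst (λ d → + 1 ℤ.≤ + suc m ℤ.- + d) (sym (ℕₚ.+-identityʳ (dim F)))
      (≤⇒≤-minus F<))
    where
    F< : suc (dim F) ≤ suc m
    F< = subst (dim F <_) (dimension-associahedron (suc m))
           (dim-strict (⊆-whole F) (λ eq → F≢ (cong (_∷ []) eq)))

-- Limits

-- Passes to unnormalised fractions, where a difference is computed by cross multiplication without
-- reduction to lowest terms.
toℚᵘ-distance : ∀ u v → toℚᵘ ℚ.∣ fromℚᵘ u ℚ.- fromℚᵘ v ∣ ℚᵘ.≃ ℚᵘ.∣ u ℚᵘ.- v ∣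
toℚᵘ-distance u v = begin-equality
  toℚᵘ ℚ.∣ x ℚ.- y ∣                  ≃⟨ ℚₚ.toℚᵘ-homo-∣-∣ (x ℚ.- y) ⟩
  ℚᵘ.∣ toℚᵘ (x ℚ.- y) ∣               ≃⟨ ℚᵘₚ.∣-∣-cong (ℚₚ.toℚᵘ-homo-+ x (ℚ.- y)) ⟩
  ℚᵘ.∣ toℚᵘ x ℚᵘ.+ toℚᵘ (ℚ.- y) ∣     ≃⟨ ℚᵘₚ.∣-∣-cong (ℚᵘₚ.+-cong (ℚₚ.toℚᵘ-fromℚᵘ u)
                                          (ℚᵘₚ.≃-trans (ℚₚ.toℚᵘ-homo‿- y) (ℚᵘₚ.-‿cong (ℚₚ.toℚᵘ-fromℚᵘ v)))) ⟩
  ℚᵘ.∣ u ℚᵘ.- v ∣                     ∎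
  where
  open ℚᵘₚ.≤-Reasoning
  x y : ℚ
  x = fromℚᵘ u
  y = fromℚᵘ v

-- The difference has numerator at most `C` over the product of the denominators, while a positive δ
-- is at least the reciprocal of its own denominator.
distance< : ∀ p p′ d d′ C δ → 0ℚ ℚ.< δ →
  ℤ.∣ p ℤ.* + suc d′ ℤ.- p′ ℤ.* + suc d ∣ ≤ C → C * ↧ₙ δ < suc d →
  ℚ.∣ p ℚ./ suc d ℚ.- p′ ℚ./ suc d′ ∣ ℚ.< δ
distance< p p′ d d′ C δ@(mkℚ (+ suc a) b _) (ℚ.*<* _) N≤C C<d =
  ℚₚ.toℚᵘ-cancel-< (ℚᵘₚ.<-respˡ-≃ (ℚᵘₚ.≃-sym (toℚᵘ-distance (mkℚᵘ p d) (mkℚᵘ p′ d′)))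
    (ℚᵘ.*<* (subst (ℤ._< + (suc a * (suc d * suc d′))) (ℤₚ.pos-* N (suc b)) (ℤ.+<+ (begin-strict
      N * suc b                  ≤⟨ ℕₚ.*-monoˡ-≤ (suc b) N≤C′ ⟩
      C * suc b                  <⟨ C<d ⟩
      suc d                      ≤⟨ ℕₚ.m≤m*n (suc d) (suc d′) ⟩
      suc d * suc d′             ≤⟨ ℕₚ.m≤n*m (suc d * suc d′) (suc a) ⟩
      suc a * (suc d * suc d′)   ∎)))))
  where
  open ℕₚ.≤-Reasoning
  -- Unnormalised subtraction negates the second numerator before cross multiplying; `N≤C′` moves
  -- the sign outside.
  N : ℕ
  N = ℤ.∣ p ℤ.* + suc d′ ℤ.+ (ℤ.- p′) ℤ.* + suc d ∣
  N≤C′ : N ≤ C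
  N≤C′ = subst (λ i → ℤ.∣ p ℤ.* + suc d′ ℤ.+ i ∣ ≤ C) (ℤₚ.neg-distribˡ-* p′ (+ suc d)) N≤C
distance< _ _ _ _ _ (mkℚ (+ zero) _ _) (ℚ.*<* (ℤ.+<+ ()))
distance< _ _ _ _ _ (mkℚ -[1+ _ ] _ _) (ℚ.*<* ())

-- 2-shortness, and the minimum excess for lengths at least two

admissible : ∀ P {k} (c : FaceChain P (2 + k)) → Admissible P c
admissible P (faceChain (_ ∷ _ ∷ _) _) ()

-- The excess is n + 1 minus the two dimensions, so `dim+dim≤n` leaves at least 1.
two-short : TwoShort associahedra
two-short n c@(faceChain (F ∷ G ∷ []) (p ∷ _)) = subst (+ 0 ℤ.<_) (sym excess₂)
  (ℤₚ.<-≤-trans (ℤ.+<+ (s≤s z≤n)) (≤⇒≤-minus {1} {dimSum P (faces c)} (s≤s (subst (λ d → dim F + d ≤ n)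
    (sym (ℕₚ.+-identityʳ (dim G))) (dim+dim≤n {F = F} {G} p)))))
  where
  P = associahedron n
  open OrientedPolytope P using (dim)
  excess₂ : excess P c ≡ + suc n ℤ.- + dimSum P (faces c)
  excess₂ = trans (excess≡ P c) (cong (ℤ._- + dimSum P (faces c))
    (trans (cong (λ d → + d ℤ.+ + 2 ℤ.- + 1) (dimension-associahedron n))
           (cong (λ d → + d ℤ.- + 1) (ℕₚ.+-comm n 2))))

+-cancelˡ-≤ : ∀ i {j k} → i ℤ.+ j ℤ.≤ i ℤ.+ k → j ℤ.≤ k
+-cancelˡ-≤ i {j} {k} p = subst₂ ℤ._≤_ (cancel i j) (cancel i k) (ℤₚ.+-monoʳ-≤ (ℤ.- i) p)
  where
  cancel : ∀ i j → ℤ.- i ℤ.+ (i ℤ.+ j) ≡ j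
  cancel = ℤ-Solver.solve-∀

minChain : ∀ k n → FaceChain (associahedron n) k
minChain k n = proj₁ (minimal-chain (associahedron n) _≼?_ (constant-chain k))

minExcess : ℕ → ℕ → ℤ
minExcess k n = excess (associahedron n) (minChain k n)

minExcess-isMin : ∀ k n → IsMinExcess (associahedron n) (2 + k) (minExcess (2 + k) n)
minExcess-isMin k n =
  (minChain (2 + k) n , admissible (associahedron n) (minChain (2 + k) n) , refl) ,
  λ c _ → proj₂ (minimal-chain (associahedron n) _≼?_ (constant-chain (2 + k))) c

-- By `excess≡`, for a fixed length the least excess belongs to the largest sum of dimensions.
maxDimSum : ℕ → ℕ → ℕ
maxDimSum k n = dimSum (associahedron n) (faces (minChain k n))

minExcess≡ : ∀ k n → minExcess k n ≡ + n ℤ.+ + k ℤ.- + 1 ℤ.- + maxDimSum k n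
minExcess≡ k n = trans (excess≡ (associahedron n) (minChain k n))
  (cong (λ d → + d ℤ.+ + k ℤ.- + 1 ℤ.- + maxDimSum k n) (dimension-associahedron n))

dimSum≤maxDimSum : ∀ {k n} (c : FaceChain (associahedron n) k) →
  dimSum (associahedron n) (faces c) ≤ maxDimSum k n
dimSum≤maxDimSum {k} {n} c = ℤₚ.drop‿+≤+ (ℤₚ.neg-cancel-≤ (+-cancelˡ-≤ m
  (subst₂ ℤ._≤_ (excess≡ P (minChain k n)) (excess≡ P c)
    (proj₂ (minimal-chain P _≼?_ (constant-chain k)) c))))
  where
  P = associahedron n
  m : ℤ
  m = + OrientedPolytope.dimension P ℤ.+ + k ℤ.- + 1

2*maxDimSum≤ : ∀ k n → 2 * maxDimSum (2 + k) n ≤ (2 + k) * n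
2*maxDimSum≤ k n = 2*dimSum≤ (associahedron n) (λ {F} {G} → dim+dim≤n {F = F} {G})
  (faces (minChain (2 + k) n)) (linked (minChain (2 + k) n))

-- Compares with `stairs` for j = x / 2. The summand 2 k of n pays for the k layers beyond j, and
-- the parity of x goes into the core; over k faces this loses at most 2 k k + k.
≤2*maxDimSum : ∀ k x → k * (x + 2 * k) ≤ 2 * maxDimSum k (x + 2 * k) + (2 * k * k + k)
≤2*maxDimSum k x = begin
  k * (x + 2 * k)                          ≡⟨ cong (λ y → k * (y + 2 * k)) x≡ ⟩
  k * (b + j * 2 + 2 * k)                  ≡⟨ lemma k b j ⟩
  2 * (k * j) + (2 * k * k + k * b)
    ≤⟨ ℕₚ.+-mono-≤ (ℕₚ.*-monoʳ-≤ 2 (ℕₚ.≤-trans (dimSum-stairs k 0 j core core-leaves) (dimSum≤maxDimSum chain)))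
                   (ℕₚ.+-monoʳ-≤ (2 * k * k) (ℕₚ.*-monoʳ-≤ k (ℕₚ.≤-pred (m%n<n x 2)))) ⟩
  2 * maxDimSum k n + (2 * k * k + k * 1)  ≡⟨ cong (λ y → 2 * maxDimSum k n + (2 * k * k + y)) (ℕₚ.*-identityʳ k) ⟩
  2 * maxDimSum k n + (2 * k * k + k)      ∎
  where
  open ℕₚ.≤-Reasoning
  n b j : ℕ
  n = x + 2 * k
  b = x % 2
  j = x / 2
  x≡ : x ≡ b + j * 2
  x≡ = m≡m%n+[m/n]*n x 2
  lemma : ∀ k b j → k * (b + j * 2 + 2 * k) ≡ 2 * (k * j) + (2 * k * k + k * b)
  lemma = solve-∀
  core : Tree
  core = lefts b (fork leaf leaf)
  core-leaves : 2 * (k + j) + leaves core ≡ 2 + n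
  core-leaves = trans (cong (_+_ (2 * (k + j))) (leaves-lefts b (fork leaf leaf)))
    (trans (lemma′ k j b) (cong (λ y → 2 + (y + 2 * k)) (sym x≡)))
    where
    lemma′ : ∀ k j b → 2 * (k + j) + (b + 2) ≡ 2 + (b + j * 2 + 2 * k)
    lemma′ = solve-∀
  chain : FaceChain (associahedron n) k
  chain = faceChain (stairs k 0 j core core-leaves)
    (stairs-linked k 0 j (Binary-lefts b (bin leaf leaf)) core-leaves)

-- Asymptotic length for chains of length 2 + k

asymptoticLength : ℕ → ℚ
asymptoticLength k = + k ℚ./ (2 + 2 * k)

pos-x+2k : ∀ x k → + (x + 2 * k) ≡ + x ℤ.+ + 2 ℤ.* + k
pos-x+2k x k = cong (ℤ._+_ (+ x)) (ℤₚ.pos-* 2 k)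

-- At n = x + 2 (2 + k) the value of `E` is negative, so `ratio` takes its last clause, with this
-- number as argument.
-E-1 : ℕ → ℕ → ℕ
-E-1 k x = suc k * x + 2 * (2 + k) * k

E≡ : ∀ k x → E (2 + k) (x + 2 * (2 + k)) ≡ -[1+ -E-1 k x ]
E≡ k x = begin
  E (2 + k) (x + 2 * (2 + k))
    ≡⟨ cong (λ n → n ℤ.- + 1 ℤ.- + (2 + k) ℤ.* (n ℤ.- + 2)) (pos-x+2k x (2 + k)) ⟩
  _ ≡⟨ lemma (+ k) (+ x) ⟩
  _ ≡⟨ cong ℤ.-_ (cong₂ (λ y z → + 1 ℤ.+ (y ℤ.+ z)) (ℤₚ.pos-* (suc k) x)
         (trans (ℤₚ.pos-* (2 * (2 + k)) k) (cong (ℤ._* + k) (ℤₚ.pos-* 2 (2 + k))))) ⟨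
  -[1+ -E-1 k x ] ∎
  where
  open ≡-Reasoning
  lemma : ∀ k x → (x ℤ.+ + 2 ℤ.* (+ 2 ℤ.+ k) ℤ.- + 1) ℤ.- (+ 2 ℤ.+ k) ℤ.* (x ℤ.+ + 2 ℤ.* (+ 2 ℤ.+ k) ℤ.- + 2) ≡
    ℤ.- (+ 1 ℤ.+ ((+ 1 ℤ.+ k) ℤ.* x ℤ.+ + 2 ℤ.* (+ 2 ℤ.+ k) ℤ.* k))
  lemma = ℤ-Solver.solve-∀

-- With n = x + 2 (2 + k), the numerator of ratio e E - k / (2 + 2 k) over the common
-- denominator (2 + 2 k) (-E), where e is the minimum excess and E = E (2 + k) n < 0.
numerator : ∀ k x → ℤ
numerator k x =
  (ℤ.- minExcess (2 + k) (x + 2 * (2 + k))) ℤ.* + (2 + 2 * k) ℤ.- + k ℤ.* + suc (-E-1 k x)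

numeratorBound : ℕ → ℕ
numeratorBound k = suc k * (2 * (2 + k) * (2 + k) + (2 + k)) + (2 + k)

-- With k / (2 + 2 k) as the limit, the terms linear in n cancel, and n enters only through the
-- deficit `T`.
numerator≡ : ∀ k x T → (2 + k) * (x + 2 * (2 + k)) ≡ 2 * maxDimSum (2 + k) (x + 2 * (2 + k)) + T →
  numerator k x ≡ ℤ.- + (suc k * T + (2 + k))
numerator≡ k x T eq = begin
  numerator k x
    ≡⟨ cong (λ e → (ℤ.- e) ℤ.* + (2 + 2 * k) ℤ.- + k ℤ.* + suc (-E-1 k x)) (minExcess≡ (2 + k) n) ⟩
  (ℤ.- (+ n ℤ.+ + (2 + k) ℤ.- + 1 ℤ.- + S)) ℤ.* + (2 + 2 * k) ℤ.- + k ℤ.* + suc (-E-1 k x)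
    ≡⟨ cong₂ (λ y z → (ℤ.- (+ n ℤ.+ + (2 + k) ℤ.- + 1 ℤ.- + S)) ℤ.* (+ 2 ℤ.+ y) ℤ.- + k ℤ.* z)
             (ℤₚ.pos-* 2 k) (cong ℤ.-_ (sym (E≡ k x))) ⟩
  (ℤ.- (+ n ℤ.+ + (2 + k) ℤ.- + 1 ℤ.- + S)) ℤ.* (+ 2 ℤ.+ + 2 ℤ.* + k) ℤ.- + k ℤ.* (ℤ.- E (2 + k) n)
    ≡⟨ lemma (+ k) (+ n) (+ S) ⟩
  ℤ.- ((+ 1 ℤ.+ + k) ℤ.* ((+ 2 ℤ.+ + k) ℤ.* + n ℤ.- + 2 ℤ.* + S) ℤ.+ (+ 2 ℤ.+ + k))
    ≡⟨ cong (λ t → ℤ.- ((+ 1 ℤ.+ + k) ℤ.* t ℤ.+ (+ 2 ℤ.+ + k))) T≡ ⟩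
  ℤ.- (+ suc k ℤ.* + T ℤ.+ + (2 + k))
    ≡⟨ cong (λ t → ℤ.- (t ℤ.+ + (2 + k))) (ℤₚ.pos-* (suc k) T) ⟨
  ℤ.- + (suc k * T + (2 + k)) ∎
  where
  open ≡-Reasoning
  n S : ℕ
  n = x + 2 * (2 + k)
  S = maxDimSum (2 + k) n
  T≡ : (+ 2 ℤ.+ + k) ℤ.* + n ℤ.- + 2 ℤ.* + S ≡ + T
  T≡ = trans (cong₂ ℤ._-_ (trans (sym (ℤₚ.pos-* (2 + k) n)) (cong +_ eq)) (sym (ℤₚ.pos-* 2 S)))
             (cancel (+ (2 * S)) (+ T))
    where
    cancel : ∀ s t → s ℤ.+ t ℤ.- s ≡ t
    cancel = ℤ-Solver.solve-∀
  lemma : ∀ k n s →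
    (ℤ.- (n ℤ.+ (+ 2 ℤ.+ k) ℤ.- + 1 ℤ.- s)) ℤ.* (+ 2 ℤ.+ + 2 ℤ.* k) ℤ.-
      k ℤ.* (ℤ.- (n ℤ.- + 1 ℤ.- (+ 2 ℤ.+ k) ℤ.* (n ℤ.- + 2))) ≡
    ℤ.- ((+ 1 ℤ.+ k) ℤ.* ((+ 2 ℤ.+ k) ℤ.* n ℤ.- + 2 ℤ.* s) ℤ.+ (+ 2 ℤ.+ k))
  lemma = ℤ-Solver.solve-∀

-- The pair bound makes the deficit `T` nonnegative, and the staircase chains bound it independently
-- of x.
∣numerator∣≤bound : ∀ k x → ℤ.∣ numerator k x ∣ ≤ numeratorBound k
∣numerator∣≤bound k x = begin
  ℤ.∣ numerator k x ∣                    ≡⟨ cong ℤ.∣_∣ (numerator≡ k x T (sym (ℕₚ.m+[n∸m]≡n (2*maxDimSum≤ k n)))) ⟩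
  ℤ.∣ ℤ.- + (suc k * T + (2 + k)) ∣      ≡⟨ ℤₚ.∣-i∣≡∣i∣ (+ (suc k * T + (2 + k))) ⟩
  suc k * T + (2 + k)                    ≤⟨ ℕₚ.+-monoˡ-≤ (2 + k) (ℕₚ.*-monoʳ-≤ (suc k) T≤) ⟩
  numeratorBound k                       ∎
  where
  open ℕₚ.≤-Reasoning
  n T : ℕ
  n = x + 2 * (2 + k)
  T = (2 + k) * n ∸ 2 * maxDimSum (2 + k) n
  T≤ : T ≤ 2 * (2 + k) * (2 + k) + (2 + k)
  T≤ = ℕₚ.m≤n+o⇒m∸n≤o _ (2 * maxDimSum (2 + k) n) (≤2*maxDimSum (2 + k) x)

-- Includes length 2, with limit 0, as the total length asks for every positive length.
asymptotic-length : ∀ k → HasAsymptoticLength associahedra (2 + k) (asymptoticLength k)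
asymptotic-length k = minExcess (2 + k) , (λ n → minExcess-isMin k n) , λ δ δ>0 →
  -- The first summand allows n = x + 2 (2 + k); the second makes x, and hence the denominator,
  -- large enough for `distance<`.
  2 * (2 + k) + numeratorBound k * ↧ₙ δ , λ n N≤n → near δ δ>0 (ℕₚ.m≤n⇒∃[o]m+o≡n N≤n)
  where
  open ℕₚ.≤-Reasoning
  near : ∀ δ → 0ℚ ℚ.< δ → ∀ {n} → (∃[ w ] 2 * (2 + k) + numeratorBound k * ↧ₙ δ + w ≡ n) →
         ℚ.∣ ratio (minExcess (2 + k) n) (E (2 + k) n) ℚ.- asymptoticLength k ∣ ℚ.< δ
  near δ δ>0 {n} (w , eq) = subst Near (trans (rearrange (2 * (2 + k)) (numeratorBound k * ↧ₙ δ) w) eq)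
    (subst (λ i → ℚ.∣ ratio (minExcess (2 + k) (x + 2 * (2 + k))) i ℚ.- asymptoticLength k ∣ ℚ.< δ)
      (sym (E≡ k x))
      (distance< (ℤ.- minExcess (2 + k) (x + 2 * (2 + k))) (+ k) (-E-1 k x) (1 + 2 * k) (numeratorBound k) δ δ>0
        (∣numerator∣≤bound k x) (s≤s (begin
          numeratorBound k * ↧ₙ δ  ≤⟨ ℕₚ.m≤m+n (numeratorBound k * ↧ₙ δ) w ⟩
          x                        ≤⟨ ℕₚ.m≤m+n x (k * x) ⟩
          suc k * x                ≤⟨ ℕₚ.m≤m+n (suc k * x) _ ⟩
          -E-1 k x                 ∎))))
    where
    Near : ℕ → Set
    Near n = ℚ.∣ ratio (minExcess (2 + k) n) (E (2 + k) n) ℚ.- asymptoticLength k ∣ ℚ.< δ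
    x : ℕ
    x = numeratorBound k * ↧ₙ δ + w
    rearrange : ∀ a b c → b + c + a ≡ a + b + c
    rearrange = solve-∀

-- Length one and the asymptotic total length

asymptotic-length-1 : HasAsymptoticLength associahedra 1 1ℚ
asymptotic-length-1 = (λ _ → + 1) , (λ { (suc m) → minimal-excess-1 m }) ,
  -- `E 1 n` is 1 for every n, so the ratio is constantly 1.
  λ δ δ>0 → 0 , λ n _ → subst (λ i → ℚ.∣ ratio (+ 1) i ℚ.- 1ℚ ∣ ℚ.< δ) (sym (E₁ (+ n))) δ>0
  where
  E₁ : ∀ n → n ℤ.- + 1 ℤ.- + 1 ℤ.* (n ℤ.- + 2) ≡ + 1
  E₁ = ℤ-Solver.solve-∀

asymptotic-total-length : HasAsymptoticTotalLength associahedra ½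
asymptotic-total-length = α , has-length , λ δ δ>0 →
  -- The cross-multiplied difference of k / (2 + 2 k) and 1 / 2 is -2, hence the bound 2; the
  -- leading 2 of the threshold is the index shift.
  2 + 2 * ↧ₙ δ , λ { (suc (suc k)) (s≤s (s≤s N≤k)) → distance< (+ k) (+ 1) (1 + 2 * k) 1 2 δ δ>0
    (ℕₚ.≤-reflexive (cong ℤ.∣_∣ (trans (cong (λ d → + k ℤ.* + 2 ℤ.- + 1 ℤ.* (+ 2 ℤ.+ d)) (ℤₚ.pos-* 2 k)) (lemma (+ k)))))
    (s≤s (ℕₚ.≤-trans N≤k (ℕₚ.≤-trans (ℕₚ.m≤m+n k (k + 0)) (ℕₚ.n≤1+n (2 * k))))) }
  where
  α : ℕ → ℚ
  -- A default value; chain lengths are positive.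
  α 0             = 0ℚ
  α 1             = 1ℚ
  α (suc (suc k)) = asymptoticLength k
  has-length : ∀ k → .{{_ : NonZero k}} → HasAsymptoticLength associahedra k (α k)
  has-length 1             = asymptotic-length-1
  has-length (suc (suc k)) = asymptotic-length k
  lemma : ∀ k → k ℤ.* + 2 ℤ.- + 1 ℤ.* (+ 2 ℤ.+ + 2 ℤ.* k) ≡ ℤ.- + 2
  lemma = ℤ-Solver.solve-∀

-- Undoes the index shift by 2, which had removed the subtractions from (k - 2) / (2 k - 2).
asymptoticLength≡ : ∀ k → asymptoticLength k ≡ ratio (+ (2 + k) ℤ.- + 2) (+ 2 ℤ.* + (2 + k) ℤ.- + 2)
asymptoticLength≡ k = sym (cong (ratio (+ k)) (trans (lemma (+ k)) (cong (ℤ._+_ (+ 2)) (sym (ℤₚ.pos-* 2 k)))))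
  where
  lemma : ∀ k → + 2 ℤ.* (+ 2 ℤ.+ k) ℤ.- + 2 ≡ + 2 ℤ.+ + 2 ℤ.* k
  lemma = ℤ-Solver.solve-∀

theorem3p5 : TwoShort associahedra ×
    ((k : ℕ) → 2 < k →
    HasAsymptoticLength associahedra k (ratio (+ k ℤ.- + 2) (+ 2 ℤ.* + k ℤ.- + 2))) ×
    HasAsymptoticTotalLength associahedra ½
theorem3p5 = two-short ,
  (λ { 1 (s≤s ()) ; (suc (suc k)) _ → subst (HasAsymptoticLength associahedra (2 + k)) (asymptoticLength≡ k) (asymptotic-length k) }) ,
  asymptotic-total-length
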